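{- Let $q\in\mathbb Q_{>0}$, $a,b\in\mathbb N$ and $n,m\in\mathbb Z$ (possibly with $nm=0$). Suppose there is $t\in\mathbb Z$ such that either $qam=t^2$ and $qbn=(t+1)^2$, or $qam=t(t-1)$ and $qbn=t(t+1)$. Then the pattern $$x,\quad y,\quad q(ax+n)(by+m)$$ is partition regular if and only if the pattern $$x,\quad y,\quad (x+qbn)(y+qam)$$ is partition regular and either (a) $qam=t^2$, $qbn=(t+1)^2$ and $\dfrac{am+bn}{2ab}-\dfrac{1}{2qab}\in\mathbb Z$, or (b) $qam=t(t-1)$, $qbn=t(t+1)$ and $\dfrac{am+bn}{2ab}\in\mathbb Z$.
   Context: $\mathbb N$ denotes the set of positive integers ($0\notin\mathbb N$). A pattern $f_1(x,y),\dots,f_k(x,y)$ (with the $f_i$ rational-valued functions) is called partition regular if, for every finite colouring (partition into finitely many pieces) of $\mathbb N$, the set of monochromatic $k$-tuples $(f_1(u,v),\dots,f_k(u,v))$ with $u,v\in\mathbb N$ is infinite; here a tuple is monochromatic if all its entries belong to $\mathbb N$ and lie in the same colour. -}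

module Defs where

open import Data.Fin.Base using (Fin)
open import Data.Integer.Base as ℤ using (ℤ; +_; 1ℤ)
open import Data.List.Base using (List)
open import Data.List.Membership.Propositional using (_∉_)
open import Data.Nat.Base as ℕ using (ℕ; suc)
open import Data.Product.Base using (∃; ∃₂; _×_)
open import Data.Rational.Base using (ℚ; Positive; NonZero; _+_; _*_; _÷_)
open import Data.Rational.Literals using (fromℤ)
open import Data.Rational.Properties using (pos*pos⇒pos; pos⇒nonZero)
open import Data.Irrelevant using ([_])
open import Data.Refinement using (Refinement-syntax; value; _,_)
open import Data.Vec.Base using (Vec; []; _∷_; map)
open import Data.Vec.Relation.Unary.All using (All)
open import Level using (Level; _⊔_)
open import Relation.Binary.PropositionalEquality.Core using (_≡_)
open import Relation.Unary using (Pred)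

private
  variable
    ℓ ℓ′ : Level

ℕ⁺ : Set
ℕ⁺ = [ n ∈ ℕ ∣ ℕ.NonZero n ]

fromℕ⁺ : ℕ⁺ → ℚ
fromℕ⁺ a = fromℤ (+ value a)

IsInteger : ℚ → Set
IsInteger p = ∃ λ (z : ℤ) → p ≡ fromℤ z

-- Infinitude in positive form: no finite list exhausts P, with a witness
-- outside each list.
Infinite : {A : Set ℓ} → Pred A ℓ′ → Set (ℓ ⊔ ℓ′)
Infinite {A = A} P = (xs : List A) → ∃ λ x → P x × x ∉ xs

Pattern : ℕ → Set
Pattern k = Vec (ℕ⁺ → ℕ⁺ → ℚ) k

tuple : ∀ {k} → Pattern k → ℕ⁺ → ℕ⁺ → Vec ℚ k
tuple fs u v = map (λ f → f u v) fs

Colouring : ℕ → Set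
Colouring r = ℕ⁺ → Fin r

Monochromatic : ∀ {r k} → Colouring r → Vec ℚ k → Set
Monochromatic χ w =
  ∃ λ c → All (λ p → ∃ λ (x : ℕ⁺) → p ≡ fromℕ⁺ x × χ x ≡ c) w

MonochromaticTuples : ∀ {r k} → Pattern k → Colouring r → Pred (Vec ℚ k) _
MonochromaticTuples fs χ w = Monochromatic χ w × ∃₂ λ u v → w ≡ tuple fs u v

-- Infinitude concerns the set of tuples of values, not the set of pairs (u , v).
PartitionRegular : ∀ {k} → Pattern k → Set
PartitionRegular fs =
  ∀ r (χ : Colouring r) → Infinite (MonochromaticTuples fs χ)

2ℚ : ℚ
2ℚ = fromℤ (+ 2)

fromℕ⁺-positive : ∀ a → Positive (fromℕ⁺ a)
fromℕ⁺-positive (suc _ , _) = _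
fromℕ⁺-positive (ℕ.zero , [ () ])

2pab-nonZero : ∀ p .{{_ : Positive p}} a b →
               NonZero (2ℚ * p * fromℕ⁺ a * fromℕ⁺ b)
2pab-nonZero p a b = pos⇒nonZero (2ℚ * p * fromℕ⁺ a * fromℕ⁺ b)
  {{pos*pos⇒pos (2ℚ * p * fromℕ⁺ a)
      {{pos*pos⇒pos (2ℚ * p) {{pos*pos⇒pos 2ℚ p}}
        (fromℕ⁺ a) {{fromℕ⁺-positive a}}}}
      (fromℕ⁺ b) {{fromℕ⁺-positive b}}}}

2ab-nonZero : ∀ a b → NonZero (2ℚ * fromℕ⁺ a * fromℕ⁺ b)
2ab-nonZero a b = pos⇒nonZero (2ℚ * fromℕ⁺ a * fromℕ⁺ b)
  {{pos*pos⇒pos (2ℚ * fromℕ⁺ a)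
      {{pos*pos⇒pos 2ℚ (fromℕ⁺ a) {{fromℕ⁺-positive a}}}}
      (fromℕ⁺ b) {{fromℕ⁺-positive b}}}}

infixl 7 _/2[_·_] _/2[_·_·_]

_/2[_·_] : ℚ → ℕ⁺ → ℕ⁺ → ℚ
p /2[ a · b ] = (p ÷ (2ℚ * fromℕ⁺ a * fromℕ⁺ b)) {{2ab-nonZero a b}}

_/2[_·_·_] : ℚ → (q : ℚ) .{{_ : Positive q}} → ℕ⁺ → ℕ⁺ → ℚ
p /2[ q · a · b ] =
  (p ÷ (2ℚ * q * fromℕ⁺ a * fromℕ⁺ b)) {{2pab-nonZero q a b}}

SquareCase : ℚ → ℕ⁺ → ℕ⁺ → ℤ → ℤ → ℤ → Set
SquareCase q a b n m t =
  q * fromℕ⁺ a * fromℤ m ≡ fromℤ (t ℤ.^ 2) ×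
  q * fromℕ⁺ b * fromℤ n ≡ fromℤ ((t ℤ.+ 1ℤ) ℤ.^ 2)

ProductCase : ℚ → ℕ⁺ → ℕ⁺ → ℤ → ℤ → ℤ → Set
ProductCase q a b n m t =
  q * fromℕ⁺ a * fromℤ m ≡ fromℤ (t ℤ.* (t ℤ.- 1ℤ)) ×
  q * fromℕ⁺ b * fromℤ n ≡ fromℤ (t ℤ.* (t ℤ.+ 1ℤ))

affineProduct : ℚ → ℕ⁺ → ℕ⁺ → ℤ → ℤ → Pattern 3
affineProduct q a b n m =
  (λ x y → fromℕ⁺ x) ∷
  (λ x y → fromℕ⁺ y) ∷
  (λ x y → q * (fromℕ⁺ a * fromℕ⁺ x + fromℤ n) * (fromℕ⁺ b * fromℕ⁺ y + fromℤ m)) ∷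
  []

shiftedProduct : ℚ → ℚ → Pattern 3
shiftedProduct r s =
  (λ x y → fromℕ⁺ x) ∷
  (λ x y → fromℕ⁺ y) ∷
  (λ x y → (fromℕ⁺ x + r) * (fromℕ⁺ y + s)) ∷
  []

{-# OPTIONS --safe #-}
module Submission where

-- Put R = q b n, S = q a m and q a b = u / v in lowest terms. Multiplying by
-- q a b turns z = q (a x + n) (b y + m) into Z = (X + R) (Y + S) for
-- X = (u / v) x, Y = (u / v) y, Z = (u / v) z. Colouring by gcd (x , v) forces
-- v ∣ x, so solutions of the first equation give integer solutions of the second
-- with u ∣ X; conversely an integer solution with u ∣ X , Y , Z scales back.
--
-- Let T = t (t + 1) in the square case and T = t² in the product case; both
-- integrality conditions say u ∣ T. A suitable finite colouring forces u ∣ X + T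
-- on all monochromatic solutions of the second equation, whence both directions.
-- In the square case X ≡ Y ≡ Z modulo u² gives (X + T)² ≡ 0, so residues suffice.
-- In the product case residues modulo u only give (X + t²) (X + t² - 1) ≡ 0, and
-- the second factor is made coprime to u by colouring, for each prime p ∣ u, by
-- the valuation and the leading p-adic digits of X + t² - 1. This needs t ≠ 0.
-- For t = 0 the second equation is Z = X Y, and the additive function Ω sends its
-- solutions to geometric ones of the first.

open import Defs
open import Data.Fin.Base using (Fin; toℕ; combine)
open import Data.Fin.Properties using (combine-injective; toℕ-fromℕ<)
open import Data.Integer.Base as ℤ using (ℤ; +_; 0ℤ; 1ℤ; ∣_∣)
import Data.Integer.Properties as ℤ
open import Data.Integer.Divisibility.Signed as ℤ∣ using (divides)
import Data.Integer.Tactic.RingSolver as ℤSolver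
open import Data.Irrelevant using ([_])
open import Data.List.Base as List using (List; []; _∷_)
open import Data.List.Membership.Propositional using (_∈_; _∉_)
open import Data.List.Membership.Propositional.Properties using (∈-map⁺)
open import Data.List.Properties using (length-++)
open import Data.List.Relation.Binary.Permutation.Propositional.Properties using (↭-length)
import Data.List.Relation.Unary.All as ListAll
open import Data.List.Relation.Unary.All.Properties using (++⁺)
open import Data.List.Relation.Unary.Any using (here; there)
open import Data.Maybe.Base using (nothing)
open import Data.Nat.Base as ℕ using (ℕ; zero; suc; NonZero; _%_; _/_; _^_; _<_; _≤_; s≤s; z≤n)
open import Data.Nat.Coprimality as Coprime using (Coprime; coprime-divisor)
open import Data.Nat.Divisibility as ℕ∣ using (_∣_; _∤_; _∣?_)
open import Data.Nat.DivMod using (_mod_; m%n<n; m≡m%n+[m/n]*n; m<n⇒m%n≡m; m*n/n≡m)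
open import Data.Nat.GCD using (gcd; gcd-greatest; gcd[m,n]∣m; gcd[m,n]∣n; gcd[m,n]≢0)
open import Data.Nat.Induction using (<-rec)
open import Data.Nat.ListAction using (product)
open import Data.Nat.ListAction.Properties using (product-++)
open import Data.Nat.Primality
  using (Prime; prime?; prime⇒nonZero; prime⇒nonTrivial; euclidsLemma; ¬prime[1])
open import Data.Nat.Primality.Factorisation
  using (PrimeFactorisation; factorise; factorisationUnique)
import Data.Nat.Properties as ℕ
import Data.Nat.Tactic.RingSolver as ℕSolver
open import Data.Product.Base using (∃; ∃₂; _×_; _,_; proj₁; proj₂)
open import Data.Rational.Base as ℚ using (ℚ; mkℚ; Positive; 1ℚ; _+_; _-_; _*_; -_; 1/_; ↥_)
open import Data.Rational.Literals using (fromℤ)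
import Data.Rational.Properties as ℚ
open import Data.Rational.Unnormalised.Base using (*≡*)
import Data.Rational.Unnormalised.Properties as ℚᵘ
open import Data.Refinement using (value; value-injective; _,_)
open import Data.Sum.Base using (_⊎_; inj₁; inj₂)
open import Data.Vec.Base as Vec using (Vec; []; _∷_)
open import Data.Vec.Relation.Unary.All using ([]; _∷_)
open import Function.Base using (_∘_)
open import Function.Bundles using (_⇔_; mk⇔)
open import Level using (0ℓ)
open import Relation.Binary.Definitions using (tri<; tri≈; tri>)
open import Relation.Binary.PropositionalEquality
open import Relation.Nullary using (¬_; Dec; yes; no; contradiction)
import Tactic.RingSolver as Solver
open import Tactic.RingSolver.Core.AlmostCommutativeRing
  using (AlmostCommutativeRing; fromCommutativeRing)

-- Finite colourings

FiniteColouring : Set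
FiniteColouring = ∃ Colouring

infix 4 _∼[_]_
_∼[_]_ : ℕ⁺ → FiniteColouring → ℕ⁺ → Set
x ∼[ κ ] y = proj₂ κ x ≡ proj₂ κ y

infixr 6 _⊗_
_⊗_ : FiniteColouring → FiniteColouring → FiniteColouring
(_ , χ) ⊗ (_ , ψ) = _ , λ x → combine (χ x) (ψ x)

⊗⁻ : ∀ κ μ {x y} → x ∼[ κ ⊗ μ ] y → x ∼[ κ ] y × x ∼[ μ ] y
⊗⁻ (_ , χ) (_ , ψ) {x} {y} = combine-injective (χ x) (ψ x) (χ y) (ψ y)

trivial : FiniteColouring
trivial = 1 , λ _ → Fin.zero

⨂ : ℕ → (ℕ → FiniteColouring) → FiniteColouring
⨂ zero    K = trivial
⨂ (suc n) K = K n ⊗ ⨂ n K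

⨂⁻ : ∀ n K {x y} → x ∼[ ⨂ n K ] y → ∀ {i} → i < n → x ∼[ K i ] y
⨂⁻ (suc n) K x∼y i<1+n with ⊗⁻ (K n) (⨂ n K) x∼y | ℕ.m<1+n⇒m<n∨m≡n i<1+n
... | _ , tail | inj₁ i<n  = ⨂⁻ n K tail i<n
... | head , _ | inj₂ refl = head

residue : (ℕ⁺ → ℕ) → (n : ℕ) .{{_ : NonZero n}} → FiniteColouring
residue f n = n , λ x → f x mod n

residue⁻ : ∀ f n .{{_ : NonZero n}} {x y} → x ∼[ residue f n ] y → f x % n ≡ f y % n
residue⁻ f n {x} {y} eq =
  trans (sym (toℕ-fromℕ< (m%n<n (f x) n))) (trans (cong toℕ eq) (toℕ-fromℕ< (m%n<n (f y) n)))

Same : FiniteColouring → ℕ⁺ → ℕ⁺ → ℕ⁺ → Set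
Same κ x y z = x ∼[ κ ] y × x ∼[ κ ] z

Same-⊗⁻ : ∀ κ μ {x y z} → Same (κ ⊗ μ) x y z → Same κ x y z × Same μ x y z
Same-⊗⁻ κ μ (xy , xz) with ⊗⁻ κ μ xy | ⊗⁻ κ μ xz
... | a , b | c , d = (a , c) , (b , d)

%≡⇒∣- : ∀ a b n .{{_ : NonZero n}} → a % n ≡ b % n → + n ℤ∣.∣ + a ℤ.- + b
%≡⇒∣- a b n eq = divides (+ (a / n) ℤ.- + (b / n)) (begin
  + a ℤ.- + b
    ≡⟨ cong₂ ℤ._-_ (expand a) (expand b) ⟩
  (+ (a % n) ℤ.+ + (a / n) ℤ.* + n) ℤ.- (+ (b % n) ℤ.+ + (b / n) ℤ.* + n)
    ≡⟨ cong (λ r → (+ r ℤ.+ + (a / n) ℤ.* + n) ℤ.- (+ (b % n) ℤ.+ + (b / n) ℤ.* + n)) eq ⟩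
  (+ (b % n) ℤ.+ + (a / n) ℤ.* + n) ℤ.- (+ (b % n) ℤ.+ + (b / n) ℤ.* + n)
    ≡⟨ identity (+ (b % n)) (+ (a / n)) (+ (b / n)) (+ n) ⟩
  (+ (a / n) ℤ.- + (b / n)) ℤ.* + n ∎)
  where
  open ≡-Reasoning
  expand : ∀ c → + c ≡ + (c % n) ℤ.+ + (c / n) ℤ.* + n
  expand c = trans (cong +_ (m≡m%n+[m/n]*n c n))
    (cong (λ i → + (c % n) ℤ.+ i) (ℤ.pos-* (c / n) n))
  identity : ∀ r i j n → (r ℤ.+ i ℤ.* n) ℤ.- (r ℤ.+ j ℤ.* n) ≡ (i ℤ.- j) ℤ.* n
  identity = ℤSolver.solve-∀

residue⇒∣- : ∀ f n .{{_ : NonZero n}} {x y} → x ∼[ residue f n ] y → + n ℤ∣.∣ + f x ℤ.- + f y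
residue⇒∣- f n {x} {y} x∼y = %≡⇒∣- (f x) (f y) n (residue⁻ f n x∼y)

i-[i-j]≡j : ∀ i j → i ℤ.- (i ℤ.- j) ≡ j
i-[i-j]≡j = ℤSolver.solve-∀

pos-≡* : ∀ {k} i j → k ≡ i ℕ.* j → + k ≡ + i ℤ.* + j
pos-≡* i j eq = trans (cong +_ eq) (ℤ.pos-* i j)

-- With equal remainders, `a < b` forces a strictly larger quotient. Applied to exponents of p, this
-- makes the term with the larger exponent vanish among the leading digits of the other.
%≡∧<⇒+≤ : ∀ {a b} m .{{_ : NonZero m}} → a % m ≡ b % m → a < b → a ℕ.+ m ≤ b
%≡∧<⇒+≤ {a} {b} m eq a<b = begin
  a ℕ.+ m                         ≡⟨ cong (ℕ._+ m) (m≡m%n+[m/n]*n a m) ⟩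
  a % m ℕ.+ a / m ℕ.* m ℕ.+ m     ≡⟨ ℕ.+-assoc (a % m) _ m ⟩
  a % m ℕ.+ (a / m ℕ.* m ℕ.+ m)   ≡⟨ cong (a % m ℕ.+_) (ℕ.+-comm _ m) ⟩
  a % m ℕ.+ suc (a / m) ℕ.* m     ≤⟨ ℕ.+-monoʳ-≤ (a % m) (ℕ.*-monoˡ-≤ m quotient<) ⟩
  a % m ℕ.+ b / m ℕ.* m           ≡⟨ cong (ℕ._+ b / m ℕ.* m) eq ⟩
  b % m ℕ.+ b / m ℕ.* m           ≡⟨ m≡m%n+[m/n]*n b m ⟨
  b                               ∎
  where
  open ℕ.≤-Reasoning
  quotient< : a / m < b / m
  quotient< = ℕ.≰⇒> λ b≤a → ℕ.<⇒≱ a<b (begin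
    b                      ≡⟨ m≡m%n+[m/n]*n b m ⟩
    b % m ℕ.+ b / m ℕ.* m  ≤⟨ ℕ.+-mono-≤ (ℕ.≤-reflexive (sym eq)) (ℕ.*-monoˡ-≤ m b≤a) ⟩
    a % m ℕ.+ a / m ℕ.* m  ≡⟨ m≡m%n+[m/n]*n a m ⟨
    a                      ∎)

-- p-adic expansions

record Adic (p n : ℕ) : Set where
  constructor adic
  field
    exponent : ℕ
    cofactor : ℕ
    factored : n ≡ p ^ exponent ℕ.* cofactor
    p∤cofactor : p ∤ cofactor

open Adic

adicExpansion : ∀ p → ℕ.NonTrivial p → ∀ n → .(NonZero n) → Adic p n
adicExpansion p p>1 = <-rec (λ n → .(NonZero n) → Adic p n) step
  where
  instance _ = p>1
  step : ∀ n → (∀ {m} → m < n → .(NonZero m) → Adic p m) → .(NonZero n) → Adic p n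
  step n@(suc _) rec _ with p ∣? n
  ... | no p∤n = adic 0 n (sym (ℕ.+-identityʳ n)) p∤n
  ... | yes p∣n with rec (ℕ∣.quotient-< p∣n) (ℕ∣.quotient≢0 p∣n)
  ...   | adic k r eq p∤r = adic (suc k) r
          (trans (ℕ∣.m∣n⇒n≡m*quotient p∣n)
            (trans (cong (p ℕ.*_) eq) (sym (ℕ.*-assoc p (p ^ k) r)))) p∤r

n<m^n : ∀ m n → 1 < m → n < m ^ n
n<m^n m zero    _   = s≤s z≤n
n<m^n m (suc n) 1<m = begin-strict
  suc n             ≤⟨ n<m^n m n 1<m ⟩
  m ^ n             ≡⟨ ℕ.*-identityˡ (m ^ n) ⟨
  1 ℕ.* m ^ n       <⟨ ℕ.*-monoˡ-< (m ^ n) {{ℕ.m^n≢0 m n {{ℕ.>-nonZero (ℕ.<-trans (s≤s z≤n) 1<m)}}}} 1<m ⟩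
  m ℕ.* m ^ n       ∎
  where open ℕ.≤-Reasoning

^-mono-∣ : ∀ m {i j} → i ≤ j → m ^ i ∣ m ^ j
^-mono-∣ m {i} i≤j with ℕ.m≤n⇒∃[o]m+o≡n i≤j
... | o , refl = subst (m ^ i ∣_) (sym (ℕ.^-distribˡ-+-* m i o)) (ℕ∣.m∣m*n (m ^ o))

module _ {p : ℕ} (pr : Prime p) where

  private instance
    p≢0 : NonZero p
    p≢0 = prime⇒nonZero pr

  -- As `p ∤ x`, Euclid's lemma puts each factor p into `e`; one factor is cancelled per step.
  ^-cancelʳ-∣ : ∀ k e {x} → p ∤ x → p ^ k ∣ e ℕ.* x → p ^ k ∣ e
  ^-cancelʳ-∣ zero    e _   _ = ℕ∣.1∣ e
  ^-cancelʳ-∣ (suc k) e {x} p∤x d with euclidsLemma e x pr (ℕ∣.m*n∣⇒m∣ p (p ^ k) d)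
  ... | inj₂ p∣x = contradiction p∣x p∤x
  ... | inj₁ (ℕ∣.divides e′ refl) =
    subst (p ℕ.* p ^ k ∣_) (ℕ.*-comm p e′) (ℕ∣.*-monoʳ-∣ p (^-cancelʳ-∣ k e′ p∤x
      (ℕ∣.*-cancelˡ-∣ p (subst (p ℕ.* p ^ k ∣_) assoc d))))
    where
    assoc : e′ ℕ.* p ℕ.* x ≡ p ℕ.* (e′ ℕ.* x)
    assoc = trans (cong (ℕ._* x) (ℕ.*-comm e′ p)) (ℕ.*-assoc p e′ x)

  ^-cancelʳ-∣ℤ : ∀ k e {x} → p ∤ x → + (p ^ k) ℤ∣.∣ e ℤ.* + x → + (p ^ k) ℤ∣.∣ e
  ^-cancelʳ-∣ℤ k e {x} p∤x d = ℤ∣.∣ᵤ⇒∣ (^-cancelʳ-∣ k ∣ e ∣ p∤x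
    (subst (p ^ k ∣_) (ℤ.abs-* e (+ x)) (ℤ∣.∣⇒∣ᵤ d)))

  -- Comparison of leading p-adic digits: the modulus p ^ (α + M) keeps M
  -- digits of e p^α x, and exponents congruent modulo M are equal or at
  -- least M apart.
  leadingDigits : ∀ {α γ x z} M .{{_ : NonZero M}} → p ∤ x → p ∤ z →
    α % M ≡ γ % M → + (p ^ M) ℤ∣.∣ + x ℤ.- + z →
    ∀ e → + (p ^ (α ℕ.+ M)) ℤ∣.∣ + (p ^ γ ℕ.* z) ℤ.- e ℤ.* + (p ^ α ℕ.* x) →
    + (p ^ M) ℤ∣.∣ e ⊎ + (p ^ M) ℤ∣.∣ e ℤ.- 1ℤ
  leadingDigits {α} {γ} {x} {z} M p∤x p∤z α≡γ x≡z e d with ℕ.<-cmp α γ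
  -- Here `α + M ≤ γ`, so the term with `p ^ γ` vanishes and `p ^ M` divides `e x`.
  ... | tri< α<γ _ _ = inj₁ (^-cancelʳ-∣ℤ M e p∤x
          (ℤ∣.*-cancelˡ-∣ (+ (p ^ α)) {{ℕ.m^n≢0 p α}} (subst₂ ℤ∣._∣_ powers move ex)))
    where
    big : + (p ^ (α ℕ.+ M)) ℤ∣.∣ + (p ^ γ ℕ.* z)
    big = ℤ∣.∣ᵤ⇒∣ (ℕ∣.∣m⇒∣m*n z (^-mono-∣ p (%≡∧<⇒+≤ M α≡γ α<γ)))
    ex : + (p ^ (α ℕ.+ M)) ℤ∣.∣ e ℤ.* + (p ^ α ℕ.* x)
    ex = subst (+ (p ^ (α ℕ.+ M)) ℤ∣.∣_) (i-[i-j]≡j (+ (p ^ γ ℕ.* z)) (e ℤ.* + (p ^ α ℕ.* x)))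
           (ℤ∣.∣m∣n⇒∣m-n big d)
    powers : + (p ^ (α ℕ.+ M)) ≡ + (p ^ α) ℤ.* + (p ^ M)
    powers = trans (cong +_ (ℕ.^-distribˡ-+-* p α M)) (ℤ.pos-* (p ^ α) (p ^ M))
    move : e ℤ.* + (p ^ α ℕ.* x) ≡ + (p ^ α) ℤ.* (e ℤ.* + x)
    move = trans (cong (e ℤ.*_) (ℤ.pos-* (p ^ α) x)) (swap e (+ (p ^ α)) (+ x))
      where
      swap : ∀ i j k → i ℤ.* (j ℤ.* k) ≡ j ℤ.* (i ℤ.* k)
      swap = ℤSolver.solve-∀
  -- Here `γ + M ≤ α`, so the term with `p ^ α` vanishes modulo `p ^ (γ + M)`, leaving `p ^ M ∣ z`.
  ... | tri> _ _ γ<α = contradiction p∣z p∤z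
    where
    γ+M≤α = %≡∧<⇒+≤ M (sym α≡γ) γ<α
    d₁ : + (p ^ (γ ℕ.+ M)) ℤ∣.∣ + (p ^ γ ℕ.* z) ℤ.- e ℤ.* + (p ^ α ℕ.* x)
    d₁ = ℤ∣.∣-trans (ℤ∣.∣ᵤ⇒∣ (^-mono-∣ p (ℕ.+-monoˡ-≤ M (ℕ.<⇒≤ γ<α)))) d
    d₂ : + (p ^ (γ ℕ.+ M)) ℤ∣.∣ e ℤ.* + (p ^ α ℕ.* x)
    d₂ = ℤ∣.∣n⇒∣m*n e (ℤ∣.∣ᵤ⇒∣ (ℕ∣.∣m⇒∣m*n x (^-mono-∣ p γ+M≤α)))
    d₃ : p ^ (γ ℕ.+ M) ∣ p ^ γ ℕ.* z
    d₃ = ℤ∣.∣⇒∣ᵤ (subst (+ (p ^ (γ ℕ.+ M)) ℤ∣.∣_)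
           (cancel (+ (p ^ γ ℕ.* z)) (e ℤ.* + (p ^ α ℕ.* x))) (ℤ∣.∣m∣n⇒∣m+n d₁ d₂))
      where
      cancel : ∀ i j → i ℤ.- j ℤ.+ j ≡ i
      cancel = ℤSolver.solve-∀
    p^M∣z : p ^ M ∣ z
    p^M∣z = ℕ∣.*-cancelˡ-∣ (p ^ γ) {{ℕ.m^n≢0 p γ}}
              (subst (_∣ p ^ γ ℕ.* z) (ℕ.^-distribˡ-+-* p γ M) d₃)
    p∣z : p ∣ z
    p∣z = ℕ∣.∣-trans (subst (_∣ p ^ M) (ℕ.*-identityʳ p) (^-mono-∣ p (ℕ.>-nonZero⁻¹ M))) p^M∣z
  -- Equal exponents cancel: `z ≡ e x` and `x ≡ z` give `(e - 1) x ≡ 0`.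
  ... | tri≈ _ refl _ = inj₂ (^-cancelʳ-∣ℤ M (e ℤ.- 1ℤ) p∤x
          (subst (+ (p ^ M) ℤ∣.∣_) (combine′ (+ x) (+ z) e)
            (ℤ∣.∣m⇒∣-m (ℤ∣.∣m∣n⇒∣m+n x≡z z≡ex))))
    where
    combine′ : ∀ x z e → ℤ.- ((x ℤ.- z) ℤ.+ (z ℤ.- e ℤ.* x)) ≡ (e ℤ.- 1ℤ) ℤ.* x
    combine′ = ℤSolver.solve-∀
    split : + (p ^ α ℕ.* z) ℤ.- e ℤ.* + (p ^ α ℕ.* x) ≡ + (p ^ α) ℤ.* (+ z ℤ.- e ℤ.* + x)
    split = trans (cong₂ (λ i j → i ℤ.- e ℤ.* j) (ℤ.pos-* (p ^ α) z) (ℤ.pos-* (p ^ α) x))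
              (factor (+ (p ^ α)) (+ z) e (+ x))
      where
      factor : ∀ i z e x → i ℤ.* z ℤ.- e ℤ.* (i ℤ.* x) ≡ i ℤ.* (z ℤ.- e ℤ.* x)
      factor = ℤSolver.solve-∀
    z≡ex : + (p ^ M) ℤ∣.∣ + z ℤ.- e ℤ.* + x
    z≡ex = ℤ∣.*-cancelˡ-∣ (+ (p ^ α)) {{ℕ.m^n≢0 p α}}
      (subst₂ ℤ∣._∣_ (trans (cong +_ (ℕ.^-distribˡ-+-* p α M)) (ℤ.pos-* (p ^ α) (p ^ M))) split d)

-- A p-adic obstruction to the product equation

module _ {p : ℕ} (pr : Prime p) {t : ℤ} (t≢0 : t ≢ 0ℤ) where

  private
    instance
      p≢0 : NonZero p
      p≢0 = prime⇒nonZero pr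

    -- The constants to be tested, 1, 2, t, 1 - t and 1 + t, have absolute value at most
    -- `2 + ∣ t ∣ < p ^ M`, so one divisible by `p ^ M` is zero.
    M = 3 ℕ.+ ∣ t ∣
    P = + (p ^ M)

    small : ∀ {e} → ∣ e ∣ ≤ 2 ℕ.+ ∣ t ∣ → P ℤ∣.∣ e → e ≡ 0ℤ
    small {e} e≤ P∣e with e ℤ.≟ 0ℤ
    ... | yes e≡0 = e≡0
    ... | no e≢0  = contradiction
      (ℕ.≤-trans (ℕ∣.∣⇒≤ {{ℤ.≢-nonZero e≢0}} (ℤ∣.∣⇒∣ᵤ P∣e)) e≤)
      (ℕ.<⇒≱ (ℕ.<-trans (ℕ.n<1+n _) (n<m^n p M (ℕ.nonTrivial⇒n>1 p {{prime⇒nonTrivial pr}}))))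

    ∤2 : ¬ (P ℤ∣.∣ + 2 ⊎ P ℤ∣.∣ + 2 ℤ.- 1ℤ)
    ∤2 (inj₁ d) = contradiction (small (s≤s (s≤s z≤n)) d) λ ()
    ∤2 (inj₂ d) = contradiction (small (s≤s z≤n) d) λ ()

    ∣t∣≡0 : P ℤ∣.∣ t → t ≡ 0ℤ
    ∣t∣≡0 = small (ℕ.m≤n⇒m≤o+n 2 ℕ.≤-refl)

    ∣1-t : P ℤ∣.∣ 1ℤ ℤ.- t ⊎ P ℤ∣.∣ 1ℤ ℤ.- t ℤ.- 1ℤ → 1ℤ ℤ.- t ≡ 0ℤ
    ∣1-t (inj₁ d) = small (ℕ.≤-trans (ℤ.∣i-j∣≤∣i∣+∣j∣ 1ℤ t) (ℕ.n≤1+n _)) d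
    ∣1-t (inj₂ d) = contradiction (∣t∣≡0 (subst (P ℤ∣.∣_) (flip t) (ℤ∣.∣m⇒∣-m d))) t≢0
      where
      flip : ∀ t → ℤ.- (1ℤ ℤ.- t ℤ.- 1ℤ) ≡ t
      flip = ℤSolver.solve-∀

    ∣1+t : P ℤ∣.∣ 1ℤ ℤ.+ t ⊎ P ℤ∣.∣ 1ℤ ℤ.+ t ℤ.- 1ℤ → 1ℤ ℤ.+ t ≡ 0ℤ
    ∣1+t (inj₁ d) = small (ℕ.≤-trans (ℤ.∣i+j∣≤∣i∣+∣j∣ 1ℤ t) (ℕ.n≤1+n _)) d
    ∣1+t (inj₂ d) = contradiction (∣t∣≡0 (subst (P ℤ∣.∣_) (flip t) d)) t≢0
      where
      flip : ∀ t → 1ℤ ℤ.+ t ℤ.- 1ℤ ≡ t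
      flip = ℤSolver.solve-∀

  -- After the dominant terms are compared the equation reads Z ≡ e X or
  -- Z ≡ e Y to M digits, where e is one of 1 - t, 1 + t and
  -- (1 - t) + (1 + t) = 2; equal leading digits force e = 0 or e = 1.
  -- If t = ±1 makes e vanish, the other coefficient is 2 and is used instead.
  adicObstruction : ∀ {α β γ x y z} → p ∤ x → p ∤ y → p ∤ z →
    α % M ≡ β % M → α % M ≡ γ % M →
    P ℤ∣.∣ + x ℤ.- + y → P ℤ∣.∣ + x ℤ.- + z →
    P ℤ∣.∣ + (p ^ α ℕ.* x) → P ℤ∣.∣ + (p ^ β ℕ.* y) →
    + (p ^ γ ℕ.* z) ≢
      + (p ^ α ℕ.* x) ℤ.* + (p ^ β ℕ.* y)
        ℤ.+ (1ℤ ℤ.- t) ℤ.* + (p ^ α ℕ.* x) ℤ.+ (1ℤ ℤ.+ t) ℤ.* + (p ^ β ℕ.* y)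
  adicObstruction {α} {β} {γ} {x} {y} {z} p∤x p∤y p∤z α≡β α≡γ x≡y x≡z P∣X P∣Y eq =
    contra (ℕ.<-cmp α β)
    where
    X = + (p ^ α ℕ.* x)
    Y = + (p ^ β ℕ.* y)
    Z = + (p ^ γ ℕ.* z)

    y≡z : P ℤ∣.∣ + y ℤ.- + z
    y≡z = subst (P ℤ∣.∣_) (difference (+ x) (+ y) (+ z)) (ℤ∣.∣m∣n⇒∣m-n x≡z x≡y)
      where
      difference : ∀ x y z → (x ℤ.- z) ℤ.- (x ℤ.- y) ≡ y ℤ.- z
      difference = ℤSolver.solve-∀

    compareX = leadingDigits pr {α} {γ} M p∤x p∤z α≡γ x≡z
    compareY = leadingDigits pr {β} {γ} M p∤y p∤z (trans (sym α≡β) α≡γ) y≡z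

    pos-^+ : ∀ k → + (p ^ (k ℕ.+ M)) ≡ + (p ^ k) ℤ.* P
    pos-^+ k = trans (cong +_ (ℕ.^-distribˡ-+-* p k M)) (ℤ.pos-* (p ^ k) (p ^ M))

    raise : ∀ k w {Q} → P ℤ∣.∣ Q → + (p ^ (k ℕ.+ M)) ℤ∣.∣ + (p ^ k ℕ.* w) ℤ.* Q
    raise k w {Q} d = subst₂ ℤ∣._∣_ (sym (pos-^+ k)) assoc
      (ℤ∣.*-monoʳ-∣ (+ (p ^ k)) (ℤ∣.∣n⇒∣m*n (+ w) d))
      where
      assoc : + (p ^ k) ℤ.* (+ w ℤ.* Q) ≡ + (p ^ k ℕ.* w) ℤ.* Q
      assoc = trans (sym (ℤ.*-assoc (+ (p ^ k)) (+ w) Q))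
                (cong (ℤ._* Q) (sym (ℤ.pos-* (p ^ k) w)))

    -- When Y is negligible against X, so is Z - (1 - t) X = Y (X + 1 + t). The alternative 1 - t ≡
    -- 1 would give t = 0.
    useX : + (p ^ (α ℕ.+ M)) ℤ∣.∣ Y → 1ℤ ℤ.- t ≡ 0ℤ
    useX d = ∣1-t (compareX (1ℤ ℤ.- t)
      (subst (+ (p ^ (α ℕ.+ M)) ℤ∣.∣_) rearrange (ℤ∣.∣m⇒∣m*n (X ℤ.+ (1ℤ ℤ.+ t)) d)))
      where
      identity : ∀ X Y t → Y ℤ.* (X ℤ.+ (1ℤ ℤ.+ t)) ≡
        X ℤ.* Y ℤ.+ (1ℤ ℤ.- t) ℤ.* X ℤ.+ (1ℤ ℤ.+ t) ℤ.* Y ℤ.- (1ℤ ℤ.- t) ℤ.* X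
      identity = ℤSolver.solve-∀
      rearrange = trans (identity X Y t) (cong (ℤ._- (1ℤ ℤ.- t) ℤ.* X) (sym eq))

    useY : + (p ^ (β ℕ.+ M)) ℤ∣.∣ X → 1ℤ ℤ.+ t ≡ 0ℤ
    useY d = ∣1+t (compareY (1ℤ ℤ.+ t)
      (subst (+ (p ^ (β ℕ.+ M)) ℤ∣.∣_) rearrange (ℤ∣.∣m⇒∣m*n (Y ℤ.+ (1ℤ ℤ.- t)) d)))
      where
      identity : ∀ X Y t → X ℤ.* (Y ℤ.+ (1ℤ ℤ.- t)) ≡
        X ℤ.* Y ℤ.+ (1ℤ ℤ.- t) ℤ.* X ℤ.+ (1ℤ ℤ.+ t) ℤ.* Y ℤ.- (1ℤ ℤ.+ t) ℤ.* Y
      identity = ℤSolver.solve-∀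
      rearrange = trans (identity X Y t) (cong (ℤ._- (1ℤ ℤ.+ t) ℤ.* Y) (sym eq))

    -- For t = 1 the equation is Z = X Y + 2 Y, and X Y is negligible against Y; the coefficient 2
    -- is congruent to neither 0 nor 1.
    t≢1 : 1ℤ ℤ.- t ≢ 0ℤ
    t≢1 a≡0 = ∤2 (compareY (+ 2) (subst (+ (p ^ (β ℕ.+ M)) ℤ∣.∣_) rearrange (raise β y P∣X)))
      where
      identity : ∀ X Y t → Y ℤ.* X ≡
        X ℤ.* Y ℤ.+ (1ℤ ℤ.- t) ℤ.* X ℤ.+ (1ℤ ℤ.+ t) ℤ.* Y
          ℤ.- + 2 ℤ.* Y ℤ.- (1ℤ ℤ.- t) ℤ.* (X ℤ.- Y)
      identity = ℤSolver.solve-∀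
      rearrange : Y ℤ.* X ≡ Z ℤ.- + 2 ℤ.* Y
      rearrange = trans (identity X Y t)
        (trans (cong₂ (λ i j → i ℤ.- + 2 ℤ.* Y ℤ.- j ℤ.* (X ℤ.- Y)) (sym eq) a≡0)
          (drop (Z ℤ.- + 2 ℤ.* Y) (X ℤ.- Y)))
        where
        drop : ∀ i j → i ℤ.- 0ℤ ℤ.* j ≡ i
        drop = ℤSolver.solve-∀

    t≢-1 : 1ℤ ℤ.+ t ≢ 0ℤ
    t≢-1 b≡0 = ∤2 (compareX (+ 2) (subst (+ (p ^ (α ℕ.+ M)) ℤ∣.∣_) rearrange (raise α x P∣Y)))
      where
      identity : ∀ X Y t → X ℤ.* Y ≡
        X ℤ.* Y ℤ.+ (1ℤ ℤ.- t) ℤ.* X ℤ.+ (1ℤ ℤ.+ t) ℤ.* Y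
          ℤ.- + 2 ℤ.* X ℤ.- (1ℤ ℤ.+ t) ℤ.* (Y ℤ.- X)
      identity = ℤSolver.solve-∀
      rearrange : X ℤ.* Y ≡ Z ℤ.- + 2 ℤ.* X
      rearrange = trans (identity X Y t)
        (trans (cong₂ (λ i j → i ℤ.- + 2 ℤ.* X ℤ.- j ℤ.* (Y ℤ.- X)) (sym eq) b≡0)
          (drop (Z ℤ.- + 2 ℤ.* X) (Y ℤ.- X)))
        where
        drop : ∀ i j → i ℤ.- 0ℤ ℤ.* j ≡ i
        drop = ℤSolver.solve-∀

    contra : ¬ _
    contra (tri< α<β _ _) =
      t≢1 (useX (ℤ∣.∣ᵤ⇒∣ (ℕ∣.∣m⇒∣m*n y (^-mono-∣ p (%≡∧<⇒+≤ M α≡β α<β)))))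
    contra (tri> _ _ β<α) =
      t≢-1 (useY (ℤ∣.∣ᵤ⇒∣ (ℕ∣.∣m⇒∣m*n x (^-mono-∣ p (%≡∧<⇒+≤ M (sym α≡β) β<α)))))
    -- Since x ≡ y and the exponents agree, X ≡ Y modulo `p ^ (α + M)`; X Y vanishes there, so Z ≡ 2
    -- X.
    contra (tri≈ _ refl _) = ∤2 (compareX (+ 2)
      (subst (+ (p ^ (α ℕ.+ M)) ℤ∣.∣_) rearrange (ℤ∣.∣m∣n⇒∣m-n (raise α x P∣Y) difference)))
      where
      difference : + (p ^ (α ℕ.+ M)) ℤ∣.∣ (X ℤ.- Y) ℤ.* (1ℤ ℤ.+ t)
      difference = ℤ∣.∣m⇒∣m*n (1ℤ ℤ.+ t) (subst₂ ℤ∣._∣_ (sym (pos-^+ α)) distrib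
        (ℤ∣.*-monoʳ-∣ (+ (p ^ α)) x≡y))
        where
        distrib : + (p ^ α) ℤ.* (+ x ℤ.- + y) ≡ X ℤ.- Y
        distrib = trans (expand (+ (p ^ α)) (+ x) (+ y))
          (sym (cong₂ ℤ._-_ (ℤ.pos-* (p ^ α) x) (ℤ.pos-* (p ^ α) y)))
          where
          expand : ∀ i j k → i ℤ.* (j ℤ.- k) ≡ i ℤ.* j ℤ.- i ℤ.* k
          expand = ℤSolver.solve-∀
      identity : ∀ X Y t → X ℤ.* Y ℤ.- (X ℤ.- Y) ℤ.* (1ℤ ℤ.+ t) ≡
        X ℤ.* Y ℤ.+ (1ℤ ℤ.- t) ℤ.* X ℤ.+ (1ℤ ℤ.+ t) ℤ.* Y ℤ.- + 2 ℤ.* X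
      identity = ℤSolver.solve-∀
      rearrange = trans (identity X Y t) (cong (ℤ._- + 2 ℤ.* X) (sym eq))

-- Colourings forcing u ∣ X + T

value≢0 : ∀ (x : ℕ⁺) → NonZero (value x)
value≢0 (suc _ , _) = _
value≢0 (zero , [ () ])

Solution : ℤ → ℤ → ℕ⁺ → ℕ⁺ → ℕ⁺ → Set
Solution R S x y z = + value z ≡ (+ value x ℤ.+ R) ℤ.* (+ value y ℤ.+ S)

-- A non-zero t makes t² - 1 nonnegative, so the shift below stays within the positive integers,
-- where p-adic expansions exist.
squareTerm : ∀ {t} → t ≢ 0ℤ → ∃ λ s → + s ≡ t ℤ.* t ℤ.- 1ℤ
squareTerm {+ zero}       t≢0 = contradiction refl t≢0
squareTerm {ℤ.+[1+ k ]}   _   = k ℕ.+ k ℕ.* suc k , refl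
squareTerm {ℤ.-[1+ k ]}   _   = k ℕ.+ k ℕ.* suc k , refl

module _ {t : ℤ} (t≢0 : t ≢ 0ℤ) where

  -- With X = x + (t² - 1) the equation z = (x + t (t + 1)) (y + t (t - 1))
  -- becomes Z = X Y + (1 - t) X + (1 + t) Y.
  shifted : ℕ⁺ → ℕ
  shifted x = value x ℕ.+ proj₁ (squareTerm t≢0)

  shifted≢0 : ∀ x → NonZero (shifted x)
  shifted≢0 x = ℕ.>-nonZero (ℕ.<-≤-trans (ℕ.>-nonZero⁻¹ (value x) {{value≢0 x}}) (ℕ.m≤m+n _ _))

  pos-shifted : ∀ x → + shifted x ≡ + value x ℤ.+ (t ℤ.* t ℤ.- 1ℤ)
  pos-shifted x = cong (λ i → + value x ℤ.+ i) (proj₂ (squareTerm t≢0))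

  shiftedEquation : ∀ {x y z} → Solution (t ℤ.* (t ℤ.+ 1ℤ)) (t ℤ.* (t ℤ.- 1ℤ)) x y z →
    + shifted z ≡ + shifted x ℤ.* + shifted y
      ℤ.+ (1ℤ ℤ.- t) ℤ.* + shifted x ℤ.+ (1ℤ ℤ.+ t) ℤ.* + shifted y
  shiftedEquation {x} {y} {z} sol = begin
    + shifted z
      ≡⟨ pos-shifted z ⟩
    + value z ℤ.+ (t ℤ.* t ℤ.- 1ℤ)
      ≡⟨ cong (ℤ._+ (t ℤ.* t ℤ.- 1ℤ)) sol ⟩
    _ ≡⟨ identity (+ value x) (+ value y) t ⟩
    _ ≡⟨ cong₂ (λ X Y → X ℤ.* Y ℤ.+ (1ℤ ℤ.- t) ℤ.* X ℤ.+ (1ℤ ℤ.+ t) ℤ.* Y)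
           (pos-shifted x) (pos-shifted y) ⟨
    + shifted x ℤ.* + shifted y
      ℤ.+ (1ℤ ℤ.- t) ℤ.* + shifted x ℤ.+ (1ℤ ℤ.+ t) ℤ.* + shifted y ∎
    where
    open ≡-Reasoning
    identity : ∀ x y t →
      (x ℤ.+ t ℤ.* (t ℤ.+ 1ℤ)) ℤ.* (y ℤ.+ t ℤ.* (t ℤ.- 1ℤ)) ℤ.+ (t ℤ.* t ℤ.- 1ℤ) ≡
      (x ℤ.+ (t ℤ.* t ℤ.- 1ℤ)) ℤ.* (y ℤ.+ (t ℤ.* t ℤ.- 1ℤ))
        ℤ.+ (1ℤ ℤ.- t) ℤ.* (x ℤ.+ (t ℤ.* t ℤ.- 1ℤ))
        ℤ.+ (1ℤ ℤ.+ t) ℤ.* (y ℤ.+ (t ℤ.* t ℤ.- 1ℤ))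
    identity = ℤSolver.solve-∀

  -- Modulo n all three shifted values equal X, and the equation becomes X ≡ X² + 2 X.
  ∣-consecutive : ∀ {n x y z} → Solution (t ℤ.* (t ℤ.+ 1ℤ)) (t ℤ.* (t ℤ.- 1ℤ)) x y z →
    n ℤ∣.∣ + shifted x ℤ.- + shifted y → n ℤ∣.∣ + shifted x ℤ.- + shifted z →
    n ℤ∣.∣ + shifted x ℤ.* + suc (shifted x)
  ∣-consecutive {n} {x} {y} {z} sol x≡y x≡z = subst (n ℤ∣.∣_) rearrange
    (ℤ∣.∣m∣n⇒∣m-n (ℤ∣.∣n⇒∣m*n (+ shifted x ℤ.+ (1ℤ ℤ.+ t)) x≡y) x≡z)
    where
    identity : ∀ X Y t →
      (X ℤ.+ (1ℤ ℤ.+ t)) ℤ.* (X ℤ.- Y)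
        ℤ.- (X ℤ.- (X ℤ.* Y ℤ.+ (1ℤ ℤ.- t) ℤ.* X ℤ.+ (1ℤ ℤ.+ t) ℤ.* Y)) ≡
      X ℤ.* (1ℤ ℤ.+ X)
    identity = ℤSolver.solve-∀
    rearrange = trans
      (cong (λ Z → (+ shifted x ℤ.+ (1ℤ ℤ.+ t)) ℤ.* (+ shifted x ℤ.- + shifted y)
                     ℤ.- (+ shifted x ℤ.- Z)) (shiftedEquation {x} {y} {z} sol))
      (identity (+ shifted x) (+ shifted y) t)

  module _ {p : ℕ} (pr : Prime p) where

    private
      instance
        p≢0 : NonZero p
        p≢0 = prime⇒nonZero pr

      M = 3 ℕ.+ ∣ t ∣

      instance
        p^M≢0 : NonZero (p ^ M)
        p^M≢0 = ℕ.m^n≢0 p M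

    expansion : ∀ x → Adic p (shifted x)
    expansion x = adicExpansion p (prime⇒nonTrivial pr) (shifted x) (shifted≢0 x)

    -- The first factor serves to lift p ∣ X to `p ^ M ∣ X`; the other two supply the congruences of
    -- exponents and cofactors for comparing leading digits.
    adicColouring : FiniteColouring
    adicColouring = residue shifted (p ^ M)
                  ⊗ residue (exponent ∘ expansion) M
                  ⊗ residue (cofactor ∘ expansion) (p ^ M)

    -- If p divides X it does not divide X + 1, so X (X + 1) ≡ 0 modulo `p ^ M` gives `p ^ M ∣ X`
    -- and then `p ^ M ∣ Y`; `adicObstruction` excludes this.
    adicColouring⇒∤ : ∀ {x y z} → Same adicColouring x y z →
      Solution (t ℤ.* (t ℤ.+ 1ℤ)) (t ℤ.* (t ℤ.- 1ℤ)) x y z → p ∤ shifted x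
    adicColouring⇒∤ {x} {y} {z} same sol p∣X
      with Same-⊗⁻ (residue shifted (p ^ M))
             (residue (exponent ∘ expansion) M ⊗ residue (cofactor ∘ expansion) (p ^ M))
             {x} {y} {z} same
    ... | (x∼y , x∼z) , rest
      with Same-⊗⁻ (residue (exponent ∘ expansion) M) (residue (cofactor ∘ expansion) (p ^ M))
             {x} {y} {z} rest
    ... | (α∼β , α∼γ) , (x′∼y′ , x′∼z′) =
      adicObstruction pr t≢0
        {exponent (expansion x)} {exponent (expansion y)} {exponent (expansion z)}
        (p∤cofactor (expansion x)) (p∤cofactor (expansion y)) (p∤cofactor (expansion z))
        (residue⁻ (exponent ∘ expansion) M {x} {y} α∼β) (residue⁻ (exponent ∘ expansion) M {x} {z} α∼γ)
        (residue⇒∣- (cofactor ∘ expansion) (p ^ M) {x} {y} x′∼y′)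
        (residue⇒∣- (cofactor ∘ expansion) (p ^ M) {x} {z} x′∼z′)
        (subst (λ n → + (p ^ M) ℤ∣.∣ + n) (factored (expansion x)) P∣X)
        (subst (λ n → + (p ^ M) ℤ∣.∣ + n) (factored (expansion y)) P∣Y)
        (rewritten (factored (expansion x)) (factored (expansion y)) (factored (expansion z)))
      where
      x≡y = residue⇒∣- shifted (p ^ M) {x} {y} x∼y
      x≡z = residue⇒∣- shifted (p ^ M) {x} {z} x∼z
      p∤1+X : p ∤ suc (shifted x)
      p∤1+X d = ¬prime[1] (subst Prime
        (ℕ∣.∣1⇒≡1 (ℕ∣.∣m+n∣m⇒∣n (subst (p ∣_) (ℕ.+-comm 1 (shifted x)) d) p∣X)) pr)
      P∣X : + (p ^ M) ℤ∣.∣ + shifted x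
      P∣X = ^-cancelʳ-∣ℤ pr M (+ shifted x) p∤1+X (∣-consecutive {_} {x} {y} {z} sol x≡y x≡z)
      P∣Y : + (p ^ M) ℤ∣.∣ + shifted y
      P∣Y = subst (+ (p ^ M) ℤ∣.∣_) (i-[i-j]≡j (+ shifted x) (+ shifted y)) (ℤ∣.∣m∣n⇒∣m-n P∣X x≡y)
      rewritten : ∀ {i j k} → shifted x ≡ i → shifted y ≡ j → shifted z ≡ k →
        + k ≡ + i ℤ.* + j ℤ.+ (1ℤ ℤ.- t) ℤ.* + i ℤ.+ (1ℤ ℤ.+ t) ℤ.* + j
      rewritten refl refl refl = shiftedEquation {x} {y} {z} sol

-- Prime divisors, coprimality and squares

primeDivisor : ∀ n .{{_ : NonZero n}} → n ≢ 1 → ∃ λ p → Prime p × p ∣ n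
primeDivisor n n≢1 with factorise n
... | record { factors = []     ; isFactorisation = eq } = contradiction eq n≢1
... | record { factors = p ∷ ps ; isFactorisation = eq ; factorsPrime = pr ListAll.∷ _ } =
  p , pr , subst (p ∣_) (sym eq) (ℕ∣.m∣m*n (product ps))

noCommonPrime⇒coprime : ∀ {m n} .{{_ : NonZero m}} → (∀ {p} → Prime p → p ∣ m → p ∤ n) → Coprime m n
noCommonPrime⇒coprime {m} none {d} (d∣m , d∣n) with d ℕ.≟ 1
... | yes d≡1 = d≡1
... | no d≢1 with primeDivisor d {{ℕ.≢-nonZero λ { refl → ℕ.≢-nonZero⁻¹ m (ℕ∣.0∣⇒≡0 d∣m) }}} d≢1
...   | p , pr , p∣d = contradiction (ℕ∣.∣-trans p∣d d∣n) (none pr (ℕ∣.∣-trans p∣d d∣m))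

-- A common divisor i of the cofactors makes i g a common divisor of m and n, hence a divisor of g.
cofactors-coprime : ∀ {m n m′ n′} g .{{_ : NonZero g}} → gcd m n ≡ g →
  m ≡ m′ ℕ.* g → n ≡ n′ ℕ.* g → Coprime m′ n′
cofactors-coprime {m} {n} g gcd≡g m≡ n≡ {i} (i∣m′ , i∣n′) = ℕ.*-cancelʳ-≡ i 1 g (trans
  (ℕ∣.∣-antisym
    (subst (i ℕ.* g ∣_) gcd≡g (gcd-greatest
      (subst (i ℕ.* g ∣_) (sym m≡) (ℕ∣.*-monoˡ-∣ g i∣m′))
      (subst (i ℕ.* g ∣_) (sym n≡) (ℕ∣.*-monoˡ-∣ g i∣n′))))
    (ℕ∣.n∣m*n i))
  (sym (ℕ.*-identityˡ g)))

-- After cancelling the square of the gcd, m′ is coprime to n′ and yet divides n′², so m′ = 1 and m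
-- is the gcd.
m*m∣n*n⇒m∣n : ∀ m n .{{_ : NonZero m}} → m ℕ.* m ∣ n ℕ.* n → m ∣ n
m*m∣n*n⇒m∣n m@(suc _) n d with gcd[m,n]∣m m n | gcd[m,n]∣n m n
... | ℕ∣.divides m′ eqm | ℕ∣.divides n′ eqn = subst (_∣ n) (sym m≡g) (gcd[m,n]∣n m n)
  where
  g = gcd m n
  instance
    g≢0 : NonZero g
    g≢0 = ℕ.≢-nonZero (gcd[m,n]≢0 m n (inj₁ λ ()))
  coprime : Coprime m′ n′
  coprime = cofactors-coprime g refl eqm eqn
  square : ∀ {k k′} → k ≡ k′ ℕ.* g → k ℕ.* k ≡ k′ ℕ.* k′ ℕ.* (g ℕ.* g)
  square {k′ = k′} refl = ℕ.[m*n]*[o*p]≡[m*o]*[n*p] k′ g k′ g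
  m′m′∣n′n′ : m′ ℕ.* m′ ∣ n′ ℕ.* n′
  m′m′∣n′n′ = ℕ∣.*-cancelʳ-∣ (g ℕ.* g) {{ℕ.m*n≢0 g g}}
    (subst₂ _∣_ (square {m} {m′} eqm) (square {n} {n′} eqn) d)
  m′≡1 : m′ ≡ 1
  m′≡1 = coprime (ℕ∣.∣-refl , coprime-divisor coprime (ℕ∣.∣-trans (ℕ∣.m∣m*n m′) m′m′∣n′n′))
  m≡g : m ≡ g
  m≡g = trans eqm (trans (cong (ℕ._* g) m′≡1) (ℕ.*-identityˡ g))

-- The forcing colourings for a modulus u

module _ (u : ℕ) .{{_ : NonZero u}} where

  private instance
    u*u≢0 : NonZero (u ℕ.* u)
    u*u≢0 = ℕ.m*n≢0 u u

  squareColouring : FiniteColouring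
  squareColouring = residue value (u ℕ.* u)

  squareColouring⇒∣ : ∀ t {x y z} → Same squareColouring x y z →
    Solution ((t ℤ.+ 1ℤ) ℤ.^ 2) (t ℤ.^ 2) x y z → + u ℤ∣.∣ + value x ℤ.+ t ℤ.* (t ℤ.+ 1ℤ)
  squareColouring⇒∣ t {x} {y} {z} (x∼y , x∼z) sol = ℤ∣.∣ᵤ⇒∣ (m*m∣n*n⇒m∣n u ∣ s ∣
    (subst (u ℕ.* u ∣_) (ℤ.abs-* s s) (ℤ∣.∣⇒∣ᵤ uu∣ss)))
    where
    s = + value x ℤ.+ t ℤ.* (t ℤ.+ 1ℤ)
    x≡y = residue⇒∣- value (u ℕ.* u) {x} {y} x∼y
    x≡z = residue⇒∣- value (u ℕ.* u) {x} {z} x∼z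
    -- The left side is (x + R) (x + S) - x, a perfect square because R + S - 1 = 2 T and R S = T².
    -- The powers are written as `ℤ.^ 2` unfolds.
    identity : ∀ x y t → (x ℤ.+ (t ℤ.+ 1ℤ) ℤ.* ((t ℤ.+ 1ℤ) ℤ.* 1ℤ)) ℤ.* (x ℤ.- y)
      ℤ.- (x ℤ.- (x ℤ.+ (t ℤ.+ 1ℤ) ℤ.* ((t ℤ.+ 1ℤ) ℤ.* 1ℤ)) ℤ.* (y ℤ.+ t ℤ.* (t ℤ.* 1ℤ))) ≡
      (x ℤ.+ t ℤ.* (t ℤ.+ 1ℤ)) ℤ.* (x ℤ.+ t ℤ.* (t ℤ.+ 1ℤ))
    identity = ℤSolver.solve-∀
    uu∣ss : + (u ℕ.* u) ℤ∣.∣ s ℤ.* s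
    uu∣ss = subst (+ (u ℕ.* u) ℤ∣.∣_)
      (trans (cong (λ Z → (+ value x ℤ.+ (t ℤ.+ 1ℤ) ℤ.^ 2) ℤ.* (+ value x ℤ.- + value y)
                     ℤ.- (+ value x ℤ.- Z)) sol)
        (identity (+ value x) (+ value y) t))
      (ℤ∣.∣m∣n⇒∣m-n (ℤ∣.∣n⇒∣m*n (+ value x ℤ.+ (t ℤ.+ 1ℤ) ℤ.^ 2) x≡y) x≡z)

  module _ {t : ℤ} (t≢0 : t ≢ 0ℤ) where

    -- The decision is an argument so that `atPrime` can split on it.
    primewise : ∀ p → Dec (Prime p) → FiniteColouring
    primewise p (yes pr) = adicColouring t≢0 pr
    primewise p (no _)   = trivial

    productColouring : FiniteColouring
    -- The index runs up to u itself, which covers every prime divisor of u.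
    productColouring = residue (shifted t≢0) u ⊗ ⨂ (suc u) (λ p → primewise p (prime? p))

    -- The modulus u divides X (X + 1) and shares no prime with X, so it divides X + 1 = x + t².
    productColouring⇒∣ : ∀ {x y z} → Same productColouring x y z →
      Solution (t ℤ.* (t ℤ.+ 1ℤ)) (t ℤ.* (t ℤ.- 1ℤ)) x y z → + u ℤ∣.∣ + value x ℤ.+ t ℤ.* t
    productColouring⇒∣ {x} {y} {z} same sol
      with Same-⊗⁻ (residue (shifted t≢0) u) (⨂ (suc u) (λ p → primewise p (prime? p)))
             {x} {y} {z} same
    ... | (x∼y , x∼z) , (x∼′y , x∼′z) = subst (+ u ℤ∣.∣_) 1+X≡ (ℤ∣.∣ᵤ⇒∣ u∣1+X)
      where
      K : ℕ → FiniteColouring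
      K p = primewise p (prime? p)
      none : ∀ {p} → Prime p → p ∣ u → p ∤ shifted t≢0 x
      none {p} pr p∣u = atPrime (prime? p)
        (⨂⁻ (suc u) K {x} {y} x∼′y p<1+u) (⨂⁻ (suc u) K {x} {z} x∼′z p<1+u)
        where
        p<1+u = s≤s (ℕ∣.∣⇒≤ p∣u)
        atPrime : ∀ d → x ∼[ primewise p d ] y → x ∼[ primewise p d ] z → p ∤ shifted t≢0 x
        atPrime (yes pr′) xy xz = adicColouring⇒∤ t≢0 pr′ {x} {y} {z} (xy , xz) sol
        atPrime (no ¬pr)  _  _  = contradiction pr ¬pr
      u∣1+X : u ∣ suc (shifted t≢0 x)
      u∣1+X = coprime-divisor (noCommonPrime⇒coprime none)
        (subst (u ∣_) (ℤ.abs-* (+ shifted t≢0 x) (+ suc (shifted t≢0 x))) (ℤ∣.∣⇒∣ᵤ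
          (∣-consecutive t≢0 {_} {x} {y} {z} sol
            (residue⇒∣- (shifted t≢0) u {x} {y} x∼y) (residue⇒∣- (shifted t≢0) u {x} {z} x∼z))))
      1+X≡ : + suc (shifted t≢0 x) ≡ + value x ℤ.+ t ℤ.* t
      1+X≡ = trans (cong (λ i → 1ℤ ℤ.+ i) (pos-shifted t≢0 x)) (cancel (+ value x) (t ℤ.* t))
        where
        cancel : ∀ i j → 1ℤ ℤ.+ (i ℤ.+ (j ℤ.- 1ℤ)) ≡ i ℤ.+ j
        cancel = ℤSolver.solve-∀

-- Rational patterns and rescaling

fromℤ-+ : ∀ i j → fromℤ (i ℤ.+ j) ≡ fromℤ i + fromℤ j
fromℤ-+ i j = ℚ.toℚᵘ-injective (ℚᵘ.≃-trans
  (*≡* (identity i j)) (ℚᵘ.≃-sym (ℚ.toℚᵘ-homo-+ (fromℤ i) (fromℤ j))))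
  where
  identity : ∀ i j → (i ℤ.+ j) ℤ.* 1ℤ ≡ (i ℤ.* 1ℤ ℤ.+ j ℤ.* 1ℤ) ℤ.* 1ℤ
  identity = ℤSolver.solve-∀

fromℤ-* : ∀ i j → fromℤ (i ℤ.* j) ≡ fromℤ i * fromℤ j
fromℤ-* i j = ℚ.toℚᵘ-injective (ℚᵘ.≃-trans
  (*≡* refl) (ℚᵘ.≃-sym (ℚ.toℚᵘ-homo-* (fromℤ i) (fromℤ j))))

fromℤ-injective : ∀ {i j} → fromℤ i ≡ fromℤ j → i ≡ j
fromℤ-injective = cong ↥_

ℚ-ring : AlmostCommutativeRing 0ℓ 0ℓ
ℚ-ring = fromCommutativeRing ℚ.+-*-commutativeRing λ _ → nothing

-- With q a b v = u, R = q b n and S = q a m this is v u z = (u x + v R) (u y + v S).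
clearing : ∀ q a b x y n m v →
  v * (q * a * b * v) * (q * (a * x + n) * (b * y + m)) ≡
  (q * a * b * v * x + v * (q * b * n)) * (q * a * b * v * y + v * (q * a * m))
clearing = Solver.solve-∀ ℚ-ring

lowestTerms : ∀ p .{{_ : Positive p}} → ∃₂ λ u v →
  NonZero u × NonZero v × Coprime u v × p * fromℤ (+ v) ≡ fromℤ (+ u)
lowestTerms p@(mkℚ (ℤ.+[1+ k ]) d c) = suc k , suc d , _ , _ , Coprime.recompute c ,
  ℚ.toℚᵘ-injective (ℚᵘ.≃-trans (ℚ.toℚᵘ-homo-* p (fromℤ (+ suc d))) (*≡* (identity (ℤ.+[1+ k ]) (+ suc d))))
  where
  identity : ∀ i j → i ℤ.* j ℤ.* 1ℤ ≡ i ℤ.* (j ℤ.* 1ℤ)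
  identity = ℤSolver.solve-∀

ℚ-*-cancelˡ : ∀ p .{{_ : ℚ.NonZero p}} {r s} → p * r ≡ p * s → r ≡ s
ℚ-*-cancelˡ p {r} {s} eq = trans (recover r) (trans (cong (1/ p *_) eq) (sym (recover s)))
  where
  recover : ∀ t → t ≡ 1/ p * (p * t)
  recover t = sym (trans (sym (ℚ.*-assoc (1/ p) p t))
    (trans (cong (_* t) (ℚ.*-inverseˡ p)) (ℚ.*-identityˡ t)))

triple : ℕ⁺ → ℕ⁺ → ℕ⁺ → Vec ℚ 3
triple x y z = fromℕ⁺ x ∷ fromℕ⁺ y ∷ fromℕ⁺ z ∷ []

fromℕ⁺-injective : ∀ {x y} → fromℕ⁺ x ≡ fromℕ⁺ y → x ≡ y
fromℕ⁺-injective {x} {y} eq = value-injective (ℤ.+-injective (fromℤ-injective eq))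

-- Partition regularity phrased through solutions of `h x y = z` in positive integers; the list `ws`
-- carries the infinitude of the set of triples.
Regular : (ℕ⁺ → ℕ⁺ → ℚ) → Set
Regular h = (κ : FiniteColouring) (ws : List (Vec ℚ 3)) →
  ∃ λ x → ∃₂ λ y z → Same κ x y z × h x y ≡ fromℕ⁺ z × triple x y z ∉ ws

withLast : (ℕ⁺ → ℕ⁺ → ℚ) → Pattern 3
withLast h = (λ x y → fromℕ⁺ x) ∷ (λ x y → fromℕ⁺ y) ∷ h ∷ []

partitionRegular⇒regular : ∀ h → PartitionRegular (withLast h) → Regular h
partitionRegular⇒regular h pr (r , χ) ws with pr r χ ws
... | _ , ((c , (x , x≡ , χx) ∷ (y , y≡ , χy) ∷ (z , z≡ , χz) ∷ []) , u , v , refl) , ∉ws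
  with fromℕ⁺-injective {u} {x} x≡ | fromℕ⁺-injective {v} {y} y≡
... | refl | refl = u , v , z , (trans χx (sym χy) , trans χx (sym χz)) , z≡ ,
  subst (λ p → fromℕ⁺ u ∷ fromℕ⁺ v ∷ p ∷ [] ∉ ws) z≡ ∉ws

regular⇒partitionRegular : ∀ h → Regular h → PartitionRegular (withLast h)
regular⇒partitionRegular h reg r χ ws with reg (r , χ) ws
... | x , y , z , (xy , xz) , eq , ∉ws =
  triple x y z ,
  ((χ x , (x , refl , refl) ∷ (y , refl , sym xy) ∷ (z , refl , sym xz) ∷ []) ,
    x , y , cong (λ p → fromℕ⁺ x ∷ fromℕ⁺ y ∷ p ∷ []) (sym eq)) ,
  ∉ws

clamp : ℕ → ℕ⁺
clamp zero      = 1 , [ _ ]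
clamp n@(suc _) = n , [ _ ]

value-clamp : ∀ n .{{_ : NonZero n}} → value (clamp n) ≡ n
value-clamp (suc _) = refl

-- This says x′ = (i / j) x for a multiple x of j; keeping the quotient w avoids division.
Scaled : ℕ → ℕ → ℕ⁺ → ℕ⁺ → Set
Scaled i j x x′ = ∃ λ w → value x ≡ w ℕ.* j × value x′ ≡ i ℕ.* w

module _ (i j : ℕ) .{{_ : NonZero i}} .{{_ : NonZero j}} where

  -- Multiplication by i / j, made total so that colourings can be pulled back along it. Off the
  -- multiples of j the rounded value, with 0 replaced by 1, is only a default.
  rescale : ℕ⁺ → ℕ⁺
  rescale x = clamp ((i ℕ.* value x) ℕ./ j)

  rescale-scaled : ∀ x → j ∣ value x → Scaled i j x (rescale x)
  rescale-scaled x (ℕ∣.divides w eq) = w , eq , trans (cong (λ n → value (clamp n)) quotient)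
    (value-clamp (i ℕ.* w) {{ℕ.m*n≢0 i w}})
    where
    instance
      w≢0 : NonZero w
      w≢0 = ℕ.m*n≢0⇒m≢0 w {{subst NonZero eq (value≢0 x)}}
    quotient : (i ℕ.* value x) ℕ./ j ≡ i ℕ.* w
    quotient = trans (cong (λ n → (i ℕ.* n) ℕ./ j) eq)
      (trans (cong (ℕ._/ j) (sym (ℕ.*-assoc i w j))) (m*n/n≡m (i ℕ.* w) j))

  module _ {ρ : ℚ} (ρi≡j : ρ * fromℤ (+ i) ≡ fromℤ (+ j)) where

    scaled-ratio : ∀ {x x′} → Scaled i j x x′ → ρ * fromℕ⁺ x′ ≡ fromℕ⁺ x
    scaled-ratio {x} {x′} (w , eq , eq′) = begin
      ρ * fromℕ⁺ x′
        ≡⟨ cong (λ n → ρ * fromℤ (+ n)) eq′ ⟩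
      ρ * fromℤ (+ (i ℕ.* w))
        ≡⟨ cong (λ n → ρ * fromℤ n) (ℤ.pos-* i w) ⟩
      ρ * fromℤ (+ i ℤ.* + w)
        ≡⟨ cong (ρ *_) (fromℤ-* (+ i) (+ w)) ⟩
      ρ * (fromℤ (+ i) * fromℤ (+ w))
        ≡⟨ ℚ.*-assoc ρ _ _ ⟨
      ρ * fromℤ (+ i) * fromℤ (+ w)
        ≡⟨ cong (_* fromℤ (+ w)) ρi≡j ⟩
      fromℤ (+ j) * fromℤ (+ w)
        ≡⟨ ℚ.*-comm (fromℤ (+ j)) (fromℤ (+ w)) ⟩
      fromℤ (+ w) * fromℤ (+ j)
        ≡⟨ fromℤ-* (+ w) (+ j) ⟨
      fromℤ (+ w ℤ.* + j)
        ≡⟨ cong fromℤ (ℤ.pos-* w j) ⟨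
      fromℤ (+ (w ℕ.* j))
        ≡⟨ cong (λ n → fromℤ (+ n)) eq ⟨
      fromℕ⁺ x ∎
      where open ≡-Reasoning

    -- The colouring κ is pulled back along `rescale` and joined to `κ₀`, whose monochromatic
    -- solutions consist of multiples of j, where `rescale` is exact.
    rescaledSolutions : ∀ {h} (κ₀ : FiniteColouring) →
      (∀ {x y z} → Same κ₀ x y z → h x y ≡ fromℕ⁺ z → (j ∣ value x) × (j ∣ value y) × (j ∣ value z)) →
      Regular h → ∀ κ ws →
      ∃ λ x → ∃₂ λ y z → ∃ λ x′ → ∃₂ λ y′ z′ →
        (Scaled i j x x′ × Scaled i j y y′ × Scaled i j z z′) ×
        h x y ≡ fromℕ⁺ z × Same κ x′ y′ z′ × triple x′ y′ z′ ∉ ws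
    rescaledSolutions {h} κ₀ divisible reg κ@(_ , χ) ws
      -- Multiplication by ρ = j / i undoes the rescaling, so the images of `ws` under it are the
      -- triples to avoid.
      with reg (κ₀ ⊗ rescaled) (List.map (Vec.map (ρ *_)) ws)
      where
      rescaled : FiniteColouring
      rescaled = _ , λ x → χ (rescale x)
    ... | x , y , z , same , eq , ∉ws
      with Same-⊗⁻ κ₀ (_ , λ x → χ (rescale x)) {x} {y} {z} same
    ... | same₀ , same′
      with divisible {x} {y} {z} same₀ eq
    ... | j∣x , j∣y , j∣z = x , y , z , _ , _ , _ , (sx , sy , sz) , eq , same′ ,
      λ ∈ws → ∉ws (subst (_∈ List.map (Vec.map (ρ *_)) ws) unscaled (∈-map⁺ (Vec.map (ρ *_)) ∈ws))
      where
      sx = rescale-scaled x j∣x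
      sy = rescale-scaled y j∣y
      sz = rescale-scaled z j∣z
      unscaled : Vec.map (ρ *_) (triple (rescale x) (rescale y) (rescale z)) ≡ triple x y z
      unscaled = cong₂ _∷_ (scaled-ratio {x} {rescale x} sx)
        (cong₂ _∷_ (scaled-ratio {y} {rescale y} sy)
          (cong (_∷ []) (scaled-ratio {z} {rescale z} sz)))

-- The two equations over the integers

affine : ℚ → ℕ⁺ → ℕ⁺ → ℤ → ℤ → ℕ⁺ → ℕ⁺ → ℚ
affine q a b n m x y =
  q * (fromℕ⁺ a * fromℕ⁺ x + fromℤ n) * (fromℕ⁺ b * fromℕ⁺ y + fromℤ m)

shift : ℚ → ℚ → ℕ⁺ → ℕ⁺ → ℚ
shift r s x y = (fromℕ⁺ x + r) * (fromℕ⁺ y + s)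

solution⇒shift : ∀ {R S x y z} → Solution R S x y z → shift (fromℤ R) (fromℤ S) x y ≡ fromℕ⁺ z
solution⇒shift {R} {S} {x} {y} {z} sol = sym (trans (cong fromℤ sol)
  (trans (fromℤ-* (+ value x ℤ.+ R) (+ value y ℤ.+ S))
    (cong₂ _*_ (fromℤ-+ (+ value x) R) (fromℤ-+ (+ value y) S))))

shift⇒solution : ∀ {R S x y z} → shift (fromℤ R) (fromℤ S) x y ≡ fromℕ⁺ z → Solution R S x y z
shift⇒solution {R} {S} {x} {y} {z} eq = fromℤ-injective (sym (trans
  (trans (fromℤ-* (+ value x ℤ.+ R) (+ value y ℤ.+ S))
    (cong₂ _*_ (fromℤ-+ (+ value x) R) (fromℤ-+ (+ value y) S))) eq))

-- The equation (u/v) z = ((u/v) x + R) ((u/v) y + S) without denominators.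
Cleared : ℕ → ℕ → ℤ → ℤ → ℕ⁺ → ℕ⁺ → ℕ⁺ → Set
Cleared u v R S x y z = + v ℤ.* + u ℤ.* + value z ≡
  (+ u ℤ.* + value x ℤ.+ + v ℤ.* R) ℤ.* (+ u ℤ.* + value y ℤ.+ + v ℤ.* S)

module _ {u v : ℕ} {R S : ℤ} {x y z x′ y′ z′ : ℕ⁺} where


  -- For x = v i, y = v j, z = v k the cleared equation is v² times the equation between u i, u j
  -- and u k; `scaled-cleared` multiplies by the same v².
  cleared-scaled : .{{_ : NonZero v}} → Scaled u v x x′ → Scaled u v y y′ → Scaled u v z z′ →
    Cleared u v R S x y z → Solution R S x′ y′ z′
  cleared-scaled (i , x≡ , x′≡) (j , y≡ , y′≡) (k , z≡ , z′≡) eq = begin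
    + value z′
      ≡⟨ pos-≡* u k z′≡ ⟩
    + u ℤ.* + k
      ≡⟨ ℤ.*-cancelʳ-≡ _ _ (+ v ℤ.* + v) {{ℤ.i*j≢0 (+ v) (+ v)}} cancelled ⟩
    (+ u ℤ.* + i ℤ.+ R) ℤ.* (+ u ℤ.* + j ℤ.+ S)
      ≡⟨ cong₂ (λ c d → (c ℤ.+ R) ℤ.* (d ℤ.+ S)) (pos-≡* u i x′≡) (pos-≡* u j y′≡) ⟨
    (+ value x′ ℤ.+ R) ℤ.* (+ value y′ ℤ.+ S) ∎
    where
    open ≡-Reasoning
    left : ∀ u v k → u ℤ.* k ℤ.* (v ℤ.* v) ≡ v ℤ.* u ℤ.* (k ℤ.* v)
    left = ℤSolver.solve-∀
    right : ∀ u v i j R S →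
      (u ℤ.* (i ℤ.* v) ℤ.+ v ℤ.* R) ℤ.* (u ℤ.* (j ℤ.* v) ℤ.+ v ℤ.* S) ≡
      (u ℤ.* i ℤ.+ R) ℤ.* (u ℤ.* j ℤ.+ S) ℤ.* (v ℤ.* v)
    right = ℤSolver.solve-∀
    cancelled : + u ℤ.* + k ℤ.* (+ v ℤ.* + v) ≡
      (+ u ℤ.* + i ℤ.+ R) ℤ.* (+ u ℤ.* + j ℤ.+ S) ℤ.* (+ v ℤ.* + v)
    cancelled = begin
      + u ℤ.* + k ℤ.* (+ v ℤ.* + v)      ≡⟨ left (+ u) (+ v) (+ k) ⟩
      + v ℤ.* + u ℤ.* (+ k ℤ.* + v)      ≡⟨ cong (+ v ℤ.* + u ℤ.*_) (pos-≡* k v z≡) ⟨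
      + v ℤ.* + u ℤ.* + value z          ≡⟨ eq ⟩
      (+ u ℤ.* + value x ℤ.+ + v ℤ.* R) ℤ.* (+ u ℤ.* + value y ℤ.+ + v ℤ.* S)
        ≡⟨ cong₂ (λ c d → (+ u ℤ.* c ℤ.+ + v ℤ.* R) ℤ.* (+ u ℤ.* d ℤ.+ + v ℤ.* S))
             (pos-≡* i v x≡) (pos-≡* j v y≡) ⟩
      (+ u ℤ.* (+ i ℤ.* + v) ℤ.+ + v ℤ.* R) ℤ.* (+ u ℤ.* (+ j ℤ.* + v) ℤ.+ + v ℤ.* S)
        ≡⟨ right (+ u) (+ v) (+ i) (+ j) R S ⟩
      (+ u ℤ.* + i ℤ.+ R) ℤ.* (+ u ℤ.* + j ℤ.+ S) ℤ.* (+ v ℤ.* + v) ∎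

  scaled-cleared : Scaled v u x x′ → Scaled v u y y′ → Scaled v u z z′ →
    Solution R S x y z → Cleared u v R S x′ y′ z′
  scaled-cleared (i , x≡ , x′≡) (j , y≡ , y′≡) (k , z≡ , z′≡) eq = begin
    + v ℤ.* + u ℤ.* + value z′               ≡⟨ cong (+ v ℤ.* + u ℤ.*_) (pos-≡* v k z′≡) ⟩
    + v ℤ.* + u ℤ.* (+ v ℤ.* + k)            ≡⟨ left (+ u) (+ v) (+ k) ⟩
    + v ℤ.* + v ℤ.* (+ k ℤ.* + u)            ≡⟨ cong (+ v ℤ.* + v ℤ.*_) (trans (sym (pos-≡* k u z≡)) eq) ⟩
    + v ℤ.* + v ℤ.* ((+ value x ℤ.+ R) ℤ.* (+ value y ℤ.+ S))
      ≡⟨ cong₂ (λ c d → + v ℤ.* + v ℤ.* ((c ℤ.+ R) ℤ.* (d ℤ.+ S))) (pos-≡* i u x≡) (pos-≡* j u y≡) ⟩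
    + v ℤ.* + v ℤ.* ((+ i ℤ.* + u ℤ.+ R) ℤ.* (+ j ℤ.* + u ℤ.+ S))
      ≡⟨ right (+ u) (+ v) (+ i) (+ j) R S ⟩
    (+ u ℤ.* (+ v ℤ.* + i) ℤ.+ + v ℤ.* R) ℤ.* (+ u ℤ.* (+ v ℤ.* + j) ℤ.+ + v ℤ.* S)
      ≡⟨ cong₂ (λ c d → (+ u ℤ.* c ℤ.+ + v ℤ.* R) ℤ.* (+ u ℤ.* d ℤ.+ + v ℤ.* S))
             (pos-≡* v i x′≡) (pos-≡* v j y′≡) ⟨
    (+ u ℤ.* + value x′ ℤ.+ + v ℤ.* R) ℤ.* (+ u ℤ.* + value y′ ℤ.+ + v ℤ.* S) ∎
    where
    open ≡-Reasoning
    left : ∀ u v k → v ℤ.* u ℤ.* (v ℤ.* k) ≡ v ℤ.* v ℤ.* (k ℤ.* u)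
    left = ℤSolver.solve-∀
    right : ∀ u v i j R S →
      v ℤ.* v ℤ.* ((i ℤ.* u ℤ.+ R) ℤ.* (j ℤ.* u ℤ.+ S)) ≡
      (u ℤ.* (v ℤ.* i) ℤ.+ v ℤ.* R) ℤ.* (u ℤ.* (v ℤ.* j) ℤ.+ v ℤ.* S)
    right = ℤSolver.solve-∀

-- With g = gcd (x , v) the reduced equation shows that v / g divides
-- u² (x / g) (y / g), to every factor of which it is coprime.
cleared⇒∣ : ∀ {u v R S x y z} .{{_ : NonZero v}} → Coprime u v →
  gcd (value x) v ≡ gcd (value y) v → gcd (value x) v ≡ gcd (value z) v →
  Cleared u v R S x y z → v ∣ value x
cleared⇒∣ {u} {v@(suc _)} {R} {S} {x} {y} {z} u⊥v x~y x~z eq = conclude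
  (gcd[m,n]∣m (value x) v)
  (subst (_∣ value y) (sym x~y) (gcd[m,n]∣m (value y) v))
  (subst (_∣ value z) (sym x~z) (gcd[m,n]∣m (value z) v))
  (gcd[m,n]∣n (value x) v)
  where
  g = gcd (value x) v
  instance
    g≢0 : NonZero g
    g≢0 = ℕ.≢-nonZero (gcd[m,n]≢0 (value x) v (inj₂ λ ()))
  conclude : g ∣ value x → g ∣ value y → g ∣ value z → g ∣ v → v ∣ value x
  conclude (ℕ∣.divides x′ x≡) (ℕ∣.divides y′ y≡) (ℕ∣.divides z′ z≡) (ℕ∣.divides v′ v≡) =
    subst (_∣ value x) (sym (trans v≡ (trans (cong (ℕ._* g) v′≡1) (ℕ.*-identityˡ g))))
      (gcd[m,n]∣m (value x) v)
    where
    v′⊥u : Coprime v′ u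
    v′⊥u (i∣v′ , i∣u) = u⊥v (i∣u , ℕ∣.∣-trans i∣v′ (subst (v′ ∣_) (sym v≡) (ℕ∣.m∣m*n g)))
    v′⊥x′ : Coprime v′ x′
    v′⊥x′ = Coprime.sym (cofactors-coprime g refl x≡ v≡)
    v′⊥y′ : Coprime v′ y′
    v′⊥y′ = Coprime.sym (cofactors-coprime g (sym x~y) y≡ v≡)
    -- The cofactor of v′ in u² x′ y′, read off the cleared equation after cancelling g².
    rhs : ℤ
    rhs = + u ℤ.* + z′ ℤ.- + u ℤ.* + x′ ℤ.* S ℤ.- R ℤ.* (+ u ℤ.* + y′) ℤ.- + v′ ℤ.* R ℤ.* S
    left : ∀ u x y v g R S → u ℤ.* (u ℤ.* (x ℤ.* y)) ℤ.* (g ℤ.* g) ≡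
      (u ℤ.* (x ℤ.* g) ℤ.+ v ℤ.* g ℤ.* R) ℤ.* (u ℤ.* (y ℤ.* g) ℤ.+ v ℤ.* g ℤ.* S)
        ℤ.- (u ℤ.* x ℤ.* S ℤ.+ R ℤ.* (u ℤ.* y) ℤ.+ v ℤ.* R ℤ.* S) ℤ.* v ℤ.* (g ℤ.* g)
    left = ℤSolver.solve-∀
    right : ∀ u x y z v g R S → v ℤ.* g ℤ.* u ℤ.* (z ℤ.* g)
        ℤ.- (u ℤ.* x ℤ.* S ℤ.+ R ℤ.* (u ℤ.* y) ℤ.+ v ℤ.* R ℤ.* S) ℤ.* v ℤ.* (g ℤ.* g) ≡
      (u ℤ.* z ℤ.- u ℤ.* x ℤ.* S ℤ.- R ℤ.* (u ℤ.* y) ℤ.- v ℤ.* R ℤ.* S) ℤ.* v ℤ.* (g ℤ.* g)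
    right = ℤSolver.solve-∀
    reduced :
      (+ u ℤ.* + value x ℤ.+ + v ℤ.* R) ℤ.* (+ u ℤ.* + value y ℤ.+ + v ℤ.* S) ≡
        + v ℤ.* + u ℤ.* + value z →
      (+ u ℤ.* (+ x′ ℤ.* + g) ℤ.+ + v′ ℤ.* + g ℤ.* R) ℤ.* (+ u ℤ.* (+ y′ ℤ.* + g) ℤ.+ + v′ ℤ.* + g ℤ.* S) ≡
      + v′ ℤ.* + g ℤ.* + u ℤ.* (+ z′ ℤ.* + g)
    reduced eq = trans (sym (cong₂ ℤ._*_
        (cong₂ (λ c d → + u ℤ.* c ℤ.+ d ℤ.* R) (pos-≡* x′ g x≡) (pos-≡* v′ g v≡))
        (cong₂ (λ c d → + u ℤ.* c ℤ.+ d ℤ.* S) (pos-≡* y′ g y≡) (pos-≡* v′ g v≡))))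
      (trans eq (cong₂ (λ c d → c ℤ.* + u ℤ.* d) (pos-≡* v′ g v≡) (pos-≡* z′ g z≡)))
    cancelled : + u ℤ.* (+ u ℤ.* (+ x′ ℤ.* + y′)) ≡ rhs ℤ.* + v′
    cancelled = ℤ.*-cancelʳ-≡ _ _ (+ g ℤ.* + g) {{ℤ.i*j≢0 (+ g) (+ g)}}
      (trans (left (+ u) (+ x′) (+ y′) (+ v′) (+ g) R S)
        (trans (cong (ℤ._- (+ u ℤ.* + x′ ℤ.* S ℤ.+ R ℤ.* (+ u ℤ.* + y′) ℤ.+ + v′ ℤ.* R ℤ.* S)
                             ℤ.* + v′ ℤ.* (+ g ℤ.* + g))
            (reduced (sym eq)))
          (right (+ u) (+ x′) (+ y′) (+ z′) (+ v′) (+ g) R S)))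
    product≡ : + u ℤ.* (+ u ℤ.* (+ x′ ℤ.* + y′)) ≡ + (u ℕ.* (u ℕ.* (x′ ℕ.* y′)))
    product≡ = sym (trans (ℤ.pos-* u _) (cong (+ u ℤ.*_) (trans (ℤ.pos-* u _) (cong (+ u ℤ.*_) (ℤ.pos-* x′ y′)))))
    v′∣ : v′ ∣ u ℕ.* (u ℕ.* (x′ ℕ.* y′))
    v′∣ = ℤ∣.∣⇒∣ᵤ (divides {+ v′} rhs (trans (sym product≡) cancelled))
    v′≡1 : v′ ≡ 1
    v′≡1 = v′⊥y′ (ℕ∣.∣-refl , coprime-divisor v′⊥x′ (coprime-divisor v′⊥u (coprime-divisor v′⊥u v′∣)))

-- Integrality conditions as divisibility by u

module _ {p c : ℚ} {T : ℤ} {u v : ℕ} .{{_ : NonZero u}} (u⊥v : Coprime u v)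
  (pv≡u : p * fromℤ (+ v) ≡ fromℤ (+ u)) (cp≡T : c * p ≡ fromℤ T) where

  private
    cu≡Tv : fromℤ (+ u) * c ≡ fromℤ (T ℤ.* + v)
    cu≡Tv = begin
      fromℤ (+ u) * c       ≡⟨ ℚ.*-comm (fromℤ (+ u)) c ⟩
      c * fromℤ (+ u)       ≡⟨ cong (c *_) pv≡u ⟨
      c * (p * fromℤ (+ v)) ≡⟨ ℚ.*-assoc c p (fromℤ (+ v)) ⟨
      c * p * fromℤ (+ v)   ≡⟨ cong (_* fromℤ (+ v)) cp≡T ⟩
      fromℤ T * fromℤ (+ v) ≡⟨ fromℤ-* T (+ v) ⟨
      fromℤ (T ℤ.* + v)     ∎
      where open ≡-Reasoning

  -- The relation c u = T v makes u divide T v when c is integral, and u is coprime to v. Conversely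
  -- T = k u gives c = k v.
  isInteger⇒∣ : IsInteger c → + u ℤ∣.∣ T
  isInteger⇒∣ (k , refl) = ℤ∣.∣ᵤ⇒∣ (coprime-divisor u⊥v
    (subst (u ∣_) (trans (ℤ.abs-* T (+ v)) (ℕ.*-comm ∣ T ∣ v))
      (ℤ∣.∣⇒∣ᵤ (divides {+ u} k (fromℤ-injective (trans (sym cu≡Tv)
        (trans (sym (fromℤ-* (+ u) k)) (cong fromℤ (ℤ.*-comm (+ u) k)))))))))

  ∣⇒isInteger : + u ℤ∣.∣ T → IsInteger c
  ∣⇒isInteger (divides k T≡) = k ℤ.* + v , ℚ-*-cancelˡ (fromℤ (+ u)) {{nonZero}} (begin
    fromℤ (+ u) * c                 ≡⟨ cu≡Tv ⟩
    fromℤ (T ℤ.* + v)               ≡⟨ cong (λ i → fromℤ (i ℤ.* + v)) T≡ ⟩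
    fromℤ (k ℤ.* + u ℤ.* + v)       ≡⟨ cong fromℤ (rearrange k (+ u) (+ v)) ⟩
    fromℤ (+ u ℤ.* (k ℤ.* + v))     ≡⟨ fromℤ-* (+ u) (k ℤ.* + v) ⟩
    fromℤ (+ u) * fromℤ (k ℤ.* + v) ∎)
    where
    open ≡-Reasoning
    nonZero : ℚ.NonZero (fromℤ (+ u))
    nonZero = ℤ.≢-nonZero (λ eq → ℕ.≢-nonZero⁻¹ u (ℤ.+-injective eq))
    rearrange : ∀ i j k → i ℤ.* j ℤ.* k ≡ j ℤ.* (i ℤ.* k)
    rearrange = ℤSolver.solve-∀

module _ (q : ℚ) .{{_ : Positive q}} (a b : ℕ⁺) (n m R S T : ℤ)
  (qbn≡R : q * fromℕ⁺ b * fromℤ n ≡ fromℤ R) (qam≡S : q * fromℕ⁺ a * fromℤ m ≡ fromℤ S) where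

  private
    d₁ = 2ℚ * fromℕ⁺ a * fromℕ⁺ b
    d₂ = 2ℚ * q * fromℕ⁺ a * fromℕ⁺ b
    instance
      d₁≢0 : ℚ.NonZero d₁
      d₁≢0 = 2ab-nonZero a b
      d₂≢0 : ℚ.NonZero d₂
      d₂≢0 = 2pab-nonZero q a b

    halve : ∀ {r} → 2ℚ * r ≡ fromℤ (+ 2 ℤ.* T) → r ≡ fromℤ T
    halve eq = ℚ-*-cancelˡ 2ℚ (trans eq (fromℤ-* (+ 2) T))

    S+R : q * fromℕ⁺ a * fromℤ m + q * fromℕ⁺ b * fromℤ n ≡ fromℤ (S ℤ.+ R)
    S+R = trans (cong₂ _+_ qam≡S qbn≡R) (sym (fromℤ-+ S R))

  -- Multiplication by 2 q a b turns the two quotients into S + R and 1.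
  squareQuotient : S ℤ.+ R ℤ.- 1ℤ ≡ + 2 ℤ.* T →
    ((fromℕ⁺ a * fromℤ m + fromℕ⁺ b * fromℤ n) /2[ a · b ] - 1ℚ /2[ q · a · b ])
      * (q * fromℕ⁺ a * fromℕ⁺ b) ≡ fromℤ T
  squareQuotient T≡ = halve (begin
    2ℚ * (((fromℕ⁺ a * fromℤ m + fromℕ⁺ b * fromℤ n) * 1/ d₁ - 1ℚ * 1/ d₂) * (q * fromℕ⁺ a * fromℕ⁺ b))
      ≡⟨ identity 2ℚ 1ℚ q (fromℕ⁺ a) (fromℕ⁺ b) (fromℤ n) (fromℤ m) (1/ d₁) (1/ d₂) ⟩
    (q * fromℕ⁺ a * fromℤ m + q * fromℕ⁺ b * fromℤ n) * (1/ d₁ * d₁) + - (1ℚ * (1/ d₂ * d₂))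
      ≡⟨ cong₂ (λ i j → (q * fromℕ⁺ a * fromℤ m + q * fromℕ⁺ b * fromℤ n) * i + - (1ℚ * j))
           (ℚ.*-inverseˡ d₁) (ℚ.*-inverseˡ d₂) ⟩
    (q * fromℕ⁺ a * fromℤ m + q * fromℕ⁺ b * fromℤ n) * 1ℚ + - (1ℚ * 1ℚ)
      ≡⟨ cong (_+ - (1ℚ * 1ℚ)) (trans (ℚ.*-identityʳ _) S+R) ⟩
    fromℤ (S ℤ.+ R) + fromℤ (ℤ.- 1ℤ)
      ≡⟨ fromℤ-+ (S ℤ.+ R) (ℤ.- 1ℤ) ⟨
    fromℤ (S ℤ.+ R ℤ.- 1ℤ)
      ≡⟨ cong fromℤ T≡ ⟩
    fromℤ (+ 2 ℤ.* T) ∎)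
    where
    open ≡-Reasoning
    -- Here t and e stand for 2 and 1, and i and j for the inverses of the two denominators.
    identity : ∀ t e q a b n m i j →
      t * (((a * m + b * n) * i + - (e * j)) * (q * a * b)) ≡
      (q * a * m + q * b * n) * (i * (t * a * b)) + - (e * (j * (t * q * a * b)))
    identity = Solver.solve-∀ ℚ-ring

  productQuotient : S ℤ.+ R ≡ + 2 ℤ.* T →
    (fromℕ⁺ a * fromℤ m + fromℕ⁺ b * fromℤ n) /2[ a · b ] * (q * fromℕ⁺ a * fromℕ⁺ b) ≡ fromℤ T
  productQuotient T≡ = halve (begin
    2ℚ * ((fromℕ⁺ a * fromℤ m + fromℕ⁺ b * fromℤ n) * 1/ d₁ * (q * fromℕ⁺ a * fromℕ⁺ b))
      ≡⟨ identity 2ℚ q (fromℕ⁺ a) (fromℕ⁺ b) (fromℤ n) (fromℤ m) (1/ d₁) ⟩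
    (q * fromℕ⁺ a * fromℤ m + q * fromℕ⁺ b * fromℤ n) * (1/ d₁ * d₁)
      ≡⟨ cong (λ i → (q * fromℕ⁺ a * fromℤ m + q * fromℕ⁺ b * fromℤ n) * i) (ℚ.*-inverseˡ d₁) ⟩
    (q * fromℕ⁺ a * fromℤ m + q * fromℕ⁺ b * fromℤ n) * 1ℚ
      ≡⟨ trans (ℚ.*-identityʳ _) S+R ⟩
    fromℤ (S ℤ.+ R)
      ≡⟨ cong fromℤ T≡ ⟩
    fromℤ (+ 2 ℤ.* T) ∎)
    where
    open ≡-Reasoning
    identity : ∀ t q a b n m i →
      t * ((a * m + b * n) * i * (q * a * b)) ≡
      (q * a * m + q * b * n) * (i * (t * a * b))
    identity = Solver.solve-∀ ℚ-ring

-- The multiplicative case t = 0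

Ω : ℕ⁺ → ℕ
Ω x = List.length (PrimeFactorisation.factors (factorise (value x) {{value≢0 x}}))

-- Concatenated prime factorisations factor the product, and factorisation is unique up to
-- permutation.
Ω-* : ∀ x y z → value z ≡ value x ℕ.* value y → Ω z ≡ Ω x ℕ.+ Ω y
Ω-* x y z eq = trans (↭-length (factorisationUnique (fact z) combined))
  (length-++ (PrimeFactorisation.factors (fact x)))
  where
  open PrimeFactorisation
  fact : ∀ x → PrimeFactorisation (value x)
  fact x = factorise (value x) {{value≢0 x}}
  combined : PrimeFactorisation (value z)
  combined = record
    { factors         = factors (fact x) List.++ factors (fact y)
    ; isFactorisation = trans eq (trans
        (cong₂ ℕ._*_ (isFactorisation (fact x)) (isFactorisation (fact y)))
        (sym (product-++ (factors (fact x)) (factors (fact y)))))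
    ; factorsPrime    = ++⁺ (factorsPrime (fact x)) (factorsPrime (fact y))
    }

Ω≡0⇒≡1 : ∀ x → Ω x ≡ 0 → value x ≡ 1
Ω≡0⇒≡1 x Ω≡0 with factorise (value x) {{value≢0 x}}
... | record { factors = [] ; isFactorisation = eq } = eq

-- First entries alone serve to leave the list; the numerator of an integer entry is the entry
-- itself.
numeratorBound : List (Vec ℚ 3) → ℕ
numeratorBound []       = 0
numeratorBound (w ∷ ws) = ∣ ↥ Vec.head w ∣ ℕ.+ numeratorBound ws

∈⇒≤numeratorBound : ∀ {w ws} → w ∈ ws → ∣ ↥ Vec.head w ∣ ≤ numeratorBound ws
∈⇒≤numeratorBound (here refl)                 = ℕ.m≤m+n _ _
∈⇒≤numeratorBound {ws = w ∷ _} (there w∈ws) =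
  ℕ.≤-trans (∈⇒≤numeratorBound w∈ws) (ℕ.m≤n+m _ ∣ ↥ Vec.head w ∣)

module _ (u v : ℕ) .{{_ : NonZero u}} .{{_ : NonZero v}} where

  private
    -- The factor u clears the denominator of v / u, and 2 keeps the base above 1 when u = 1.
    base = 2 ℕ.* u
    1<base : 1 < base
    1<base = ℕ.*-monoʳ-≤ 2 (ℕ.>-nonZero⁻¹ u)
    instance
      base≢0 : NonZero base
      base≢0 = ℕ.m*n≢0 2 u

  -- For k > 0 this is (v / u) (2 u)^k.
  power : ℕ → ℕ⁺
  -- The formula would give v / u, possibly not an integer; 1 is a default, as the exponents that
  -- occur are positive.
  power zero    = 1 , [ _ ]
  power (suc k) = clamp (v ℕ.* (2 ℕ.* base ^ k))

  private
    value-power : ∀ k → value (power (suc k)) ≡ v ℕ.* (2 ℕ.* base ^ k)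
    value-power k = value-clamp _ {{nonZero}}
      where
      instance
        doubled : NonZero (2 ℕ.* base ^ k)
        doubled = ℕ.m*n≢0 2 (base ^ k) {{_}} {{ℕ.m^n≢0 base k}}
      nonZero : NonZero (v ℕ.* (2 ℕ.* base ^ k))
      nonZero = ℕ.m*n≢0 v (2 ℕ.* base ^ k)

  u*power : ∀ k → 0 < k → u ℕ.* value (power k) ≡ v ℕ.* base ^ k
  u*power (suc k) _ = trans (cong (u ℕ.*_) (value-power k)) (rearrange u v (base ^ k))
    where
    rearrange : ∀ u v w → u ℕ.* (v ℕ.* (2 ℕ.* w)) ≡ v ℕ.* (2 ℕ.* u ℕ.* w)
    rearrange = ℕSolver.solve-∀

  power-≥ : ∀ k → k ≤ value (power k)
  power-≥ zero    = z≤n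
  power-≥ (suc k) = begin
    suc k                    ≤⟨ n<m^n base k 1<base ⟩
    base ^ k                 ≤⟨ ℕ.m≤n*m (base ^ k) 2 ⟩
    2 ℕ.* base ^ k           ≤⟨ ℕ.m≤n*m (2 ℕ.* base ^ k) v ⟩
    v ℕ.* (2 ℕ.* base ^ k)   ≡⟨ value-power k ⟨
    value (power (suc k))    ∎
    where open ℕ.≤-Reasoning

  -- Since u (v / u) (2 u)^k = v (2 u)^k, adding exponents becomes v u z = (u x) (u y).
  power-cleared : ∀ {i j} → 0 < i → 0 < j → Cleared u v 0ℤ 0ℤ (power i) (power j) (power (i ℕ.+ j))
  power-cleared {i} {j} 0<i 0<j = begin
    + v ℤ.* + u ℤ.* + value (power (i ℕ.+ j))
      ≡⟨ ℤ.*-assoc (+ v) (+ u) _ ⟩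
    + v ℤ.* (+ u ℤ.* + value (power (i ℕ.+ j)))
      ≡⟨ cong (+ v ℤ.*_) (cast (i ℕ.+ j) (ℕ.<-≤-trans 0<i (ℕ.m≤m+n i j))) ⟩
    + v ℤ.* (+ v ℤ.* + (base ^ (i ℕ.+ j)))
      ≡⟨ cong (λ n → + v ℤ.* (+ v ℤ.* n))
           (trans (cong +_ (ℕ.^-distribˡ-+-* base i j)) (ℤ.pos-* (base ^ i) (base ^ j))) ⟩
    + v ℤ.* (+ v ℤ.* (+ (base ^ i) ℤ.* + (base ^ j)))
      ≡⟨ rearrange (+ v) (+ (base ^ i)) (+ (base ^ j)) ⟩
    (+ v ℤ.* + (base ^ i) ℤ.+ + v ℤ.* 0ℤ) ℤ.* (+ v ℤ.* + (base ^ j) ℤ.+ + v ℤ.* 0ℤ)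
      ≡⟨ cong₂ (λ c d → (c ℤ.+ + v ℤ.* 0ℤ) ℤ.* (d ℤ.+ + v ℤ.* 0ℤ)) (cast i 0<i) (cast j 0<j) ⟨
    (+ u ℤ.* + value (power i) ℤ.+ + v ℤ.* 0ℤ) ℤ.* (+ u ℤ.* + value (power j) ℤ.+ + v ℤ.* 0ℤ) ∎
    where
    open ≡-Reasoning
    cast : ∀ k → 0 < k → + u ℤ.* + value (power k) ≡ + v ℤ.* + (base ^ k)
    cast k 0<k = trans (sym (ℤ.pos-* u (value (power k))))
      (trans (cong +_ (u*power k 0<k)) (ℤ.pos-* v (base ^ k)))
    rearrange : ∀ v i j → v ℤ.* (v ℤ.* (i ℤ.* j)) ≡
      (v ℤ.* i ℤ.+ v ℤ.* 0ℤ) ℤ.* (v ℤ.* j ℤ.+ v ℤ.* 0ℤ)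
    rearrange = ℤSolver.solve-∀

  -- Completely additive Ω turns z = x y into a Schur triple of exponents.
  -- Colouring by Ω ⊓ (N + 1) makes all exponents exceed N, since k + k = k
  -- only for k = 0, which is excluded with the triple (1 , 1 , 1).
  multiplicative-transfer : ∀ {h} →
    (∀ {x y z} → Cleared u v 0ℤ 0ℤ x y z → h x y ≡ fromℕ⁺ z) →
    Regular (shift (fromℤ 0ℤ) (fromℤ 0ℤ)) → Regular h
  multiplicative-transfer {h} cleared⇒h reg (r , χ) ws =
    let x , y , z , same , eq , ∉1 = reg (residue capped (2 ℕ.+ N) ⊗ powers) (triple 1⁺ 1⁺ 1⁺ ∷ [])
        sameΩ , same′ = Same-⊗⁻ (residue capped (2 ℕ.+ N)) powers {x} {y} {z} same
        N<Ωx , 0<Ωy , Ωz = exponents {x} {y} {z} sameΩ eq ∉1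
    in power (Ω x) , power (Ω y) , power (Ω z) , same′ ,
       cleared⇒h {power (Ω x)} {power (Ω y)} {power (Ω z)}
         (subst (λ k → Cleared u v 0ℤ 0ℤ (power (Ω x)) (power (Ω y)) (power k)) (sym Ωz)
           (power-cleared (ℕ.≤-<-trans z≤n N<Ωx) 0<Ωy)) ,
       λ ∈ws → ℕ.<⇒≱ N<Ωx (ℕ.≤-trans (power-≥ (Ω x)) (∈⇒≤numeratorBound ∈ws))
    where
    N = numeratorBound ws
    1⁺ : ℕ⁺
    1⁺ = 1 , [ _ ]
    capped : ℕ⁺ → ℕ
    capped x = Ω x ℕ.⊓ suc N
    powers : FiniteColouring
    powers = r , χ ∘ power ∘ Ω
    -- Capped values are at most `N + 1`, so the modulus `N + 2` separates them.
    uncap : ∀ {x y} → x ∼[ residue capped (2 ℕ.+ N) ] y → capped x ≡ capped y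
    uncap {x} {y} x∼y = trans (sym (small x)) (trans (residue⁻ capped (2 ℕ.+ N) {x} {y} x∼y) (small y))
      where
      small : ∀ x → capped x ℕ.% (2 ℕ.+ N) ≡ capped x
      small x = m<n⇒m%n≡m (s≤s (ℕ.m⊓n≤n (Ω x) (suc N)))
    capped⁻ : ∀ {x y} → Ω x ≤ N → capped x ≡ capped y → Ω x ≡ Ω y
    capped⁻ {x} {y} Ωx≤N c with ℕ.≤-total (Ω y) (suc N)
    ... | inj₁ Ωy≤ = trans (sym (ℕ.m≤n⇒m⊓n≡m (ℕ.m≤n⇒m≤1+n Ωx≤N))) (trans c (ℕ.m≤n⇒m⊓n≡m Ωy≤))
    ... | inj₂ Ωy≥ = contradiction
      (trans (sym (ℕ.m≤n⇒m⊓n≡m (ℕ.m≤n⇒m≤1+n Ωx≤N))) (trans c (ℕ.m≥n⇒m⊓n≡n Ωy≥)))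
      (ℕ.<⇒≢ (s≤s Ωx≤N))
    exponents : ∀ {x y z} → Same (residue capped (2 ℕ.+ N)) x y z →
      shift (fromℤ 0ℤ) (fromℤ 0ℤ) x y ≡ fromℕ⁺ z → triple x y z ∉ triple 1⁺ 1⁺ 1⁺ ∷ [] →
      N < Ω x × 0 < Ω y × Ω z ≡ Ω x ℕ.+ Ω y
    exponents {x} {y} {z} (x∼y , x∼z) eq ∉1 = N<Ωx , 0<Ωy , Ωz
      where
      z≡xy : value z ≡ value x ℕ.* value y
      z≡xy = ℤ.+-injective (trans (shift⇒solution {0ℤ} {0ℤ} {x} {y} {z} eq)
        (trans (cong₂ ℤ._*_ (ℤ.+-identityʳ (+ value x)) (ℤ.+-identityʳ (+ value y)))
          (sym (ℤ.pos-* (value x) (value y)))))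
      Ωz : Ω z ≡ Ω x ℕ.+ Ω y
      Ωz = Ω-* x y z z≡xy
      N<Ωx : N < Ω x
      N<Ωx = ℕ.≰⇒> λ Ωx≤N →
        let Ωx≡Ωy = capped⁻ {x} {y} Ωx≤N (uncap {x} {y} x∼y)
            Ωx≡Ωz = capped⁻ {x} {z} Ωx≤N (uncap {x} {z} x∼z)
            Ωy≡0  = ℕ.+-cancelˡ-≡ (Ω x) (Ω y) 0
                      (trans (sym Ωz) (trans (sym Ωx≡Ωz) (sym (ℕ.+-identityʳ (Ω x)))))
            Ωx≡0  = trans Ωx≡Ωy Ωy≡0
            one : ∀ w → Ω x ≡ Ω w → fromℕ⁺ w ≡ 1ℚ
            one w Ωx≡Ωw = cong (λ n → fromℤ (+ n)) (Ω≡0⇒≡1 w (trans (sym Ωx≡Ωw) Ωx≡0))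
        in ∉1 (here (cong₂ _∷_ (one x refl) (cong₂ _∷_ (one y Ωx≡Ωy) (cong (_∷ []) (one z Ωx≡Ωz)))))
      0<Ωy : 0 < Ω y
      0<Ωy = ℕ.n≢0⇒n>0 λ Ωy≡0 → contradiction
        (trans (sym (ℕ.m≥n⇒m⊓n≡n N<Ωx)) (trans (uncap {x} {y} x∼y) (cong (ℕ._⊓ suc N) Ωy≡0)))
        λ ()

-- The equivalence

-- A common interface to the square case and the product case with t ≠ 0, so that each transfer is
-- proved once.
record Forcing (R S T : ℤ) (u : ℕ) : Set where
  field
    colouring : FiniteColouring
    forced    : ∀ {x y z} → Same colouring x y z → Solution R S x y z → + u ℤ∣.∣ + value x ℤ.+ T

open Forcing

-- Transfer between the two patterns

module _ (q : ℚ) .{{_ : Positive q}} (a b : ℕ⁺) (n m : ℤ) {R S : ℤ} {u v : ℕ}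
  .{{_ : NonZero u}} .{{_ : NonZero v}} (u⊥v : Coprime u v)
  (λv≡u : q * fromℕ⁺ a * fromℕ⁺ b * fromℤ (+ v) ≡ fromℤ (+ u))
  (qbn≡R : q * fromℕ⁺ b * fromℤ n ≡ fromℤ R)
  (qam≡S : q * fromℕ⁺ a * fromℤ m ≡ fromℤ S) where

  private
    h = affine q a b n m

    affine-cleared : ∀ x y → fromℤ (+ v ℤ.* + u) * h x y ≡
      fromℤ ((+ u ℤ.* + value x ℤ.+ + v ℤ.* R) ℤ.* (+ u ℤ.* + value y ℤ.+ + v ℤ.* S))
    affine-cleared x y = begin
      fromℤ (+ v ℤ.* + u) * h x y
        ≡⟨ cong (_* h x y) (fromℤ-* (+ v) (+ u)) ⟩
      fromℤ (+ v) * fromℤ (+ u) * h x y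
        ≡⟨ cong (λ p → fromℤ (+ v) * p * h x y) λv≡u ⟨
      fromℤ (+ v) * (q * fromℕ⁺ a * fromℕ⁺ b * fromℤ (+ v)) * h x y
        ≡⟨ clearing q (fromℕ⁺ a) (fromℕ⁺ b) (fromℕ⁺ x) (fromℕ⁺ y) (fromℤ n) (fromℤ m) (fromℤ (+ v)) ⟩
      _ ≡⟨ cong₂ _*_ (factor (fromℕ⁺ x) qbn≡R) (factor (fromℕ⁺ y) qam≡S) ⟩
      (fromℤ (+ u) * fromℕ⁺ x + fromℤ (+ v) * fromℤ R) * (fromℤ (+ u) * fromℕ⁺ y + fromℤ (+ v) * fromℤ S)
        ≡⟨ cong₂ _*_ (homomorphic (+ value x) R) (homomorphic (+ value y) S) ⟨
      fromℤ (+ u ℤ.* + value x ℤ.+ + v ℤ.* R) * fromℤ (+ u ℤ.* + value y ℤ.+ + v ℤ.* S)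
        ≡⟨ fromℤ-* (+ u ℤ.* + value x ℤ.+ + v ℤ.* R) (+ u ℤ.* + value y ℤ.+ + v ℤ.* S) ⟨
      fromℤ ((+ u ℤ.* + value x ℤ.+ + v ℤ.* R) ℤ.* (+ u ℤ.* + value y ℤ.+ + v ℤ.* S)) ∎
      where
      open ≡-Reasoning
      factor : ∀ w {p r} → p ≡ r →
        q * fromℕ⁺ a * fromℕ⁺ b * fromℤ (+ v) * w + fromℤ (+ v) * p ≡ fromℤ (+ u) * w + fromℤ (+ v) * r
      factor w p≡r = cong₂ (λ i j → i * w + fromℤ (+ v) * j) λv≡u p≡r
      homomorphic : ∀ w r →
        fromℤ (+ u ℤ.* w ℤ.+ + v ℤ.* r) ≡ fromℤ (+ u) * fromℤ w + fromℤ (+ v) * fromℤ r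
      homomorphic w r = trans (fromℤ-+ (+ u ℤ.* w) (+ v ℤ.* r))
        (cong₂ _+_ (fromℤ-* (+ u) w) (fromℤ-* (+ v) r))

    affine⇒cleared : ∀ {x y z} → h x y ≡ fromℕ⁺ z → Cleared u v R S x y z
    affine⇒cleared {x} {y} {z} eq = fromℤ-injective (trans (fromℤ-* (+ v ℤ.* + u) (+ value z))
      (trans (cong (fromℤ (+ v ℤ.* + u) *_) (sym eq)) (affine-cleared x y)))

    cleared⇒affine : ∀ {x y z} → Cleared u v R S x y z → h x y ≡ fromℕ⁺ z
    cleared⇒affine {x} {y} {z} eq = ℚ-*-cancelˡ (fromℤ (+ v ℤ.* + u)) {{nonZero}}
      (trans (affine-cleared x y) (trans (cong fromℤ (sym eq)) (fromℤ-* (+ v ℤ.* + u) (+ value z))))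
      where
      nonZero : ℚ.NonZero (fromℤ (+ v ℤ.* + u))
      nonZero = ℤ.i*j≢0 (+ v) (+ u)

    p>0 : Positive (q * fromℕ⁺ a * fromℕ⁺ b)
    p>0 = ℚ.pos*pos⇒pos (q * fromℕ⁺ a) {{ℚ.pos*pos⇒pos q (fromℕ⁺ a) {{fromℕ⁺-positive a}}}}
            (fromℕ⁺ b) {{fromℕ⁺-positive b}}

    p = q * fromℕ⁺ a * fromℕ⁺ b
    instance
      p≢0 : ℚ.NonZero p
      p≢0 = ℚ.pos⇒nonZero p {{p>0}}

    inverse : 1/ p * fromℤ (+ u) ≡ fromℤ (+ v)
    inverse = ℚ-*-cancelˡ p (trans (sym (ℚ.*-assoc p (1/ p) (fromℤ (+ u))))
      (trans (cong (_* fromℤ (+ u)) (ℚ.*-inverseʳ p)) (trans (ℚ.*-identityˡ _) (sym λv≡u))))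

    -- A gcd with v is at most v, so its residue modulo `suc v` is the gcd itself.
    gcdColouring : FiniteColouring
    gcdColouring = residue (λ x → gcd (value x) v) (suc v)

    gcd≡ : ∀ {x y} → x ∼[ gcdColouring ] y → gcd (value x) v ≡ gcd (value y) v
    gcd≡ {x} {y} x∼y = trans (sym (small x))
      (trans (residue⁻ (λ x → gcd (value x) v) (suc v) {x} {y} x∼y) (small y))
      where
      small : ∀ x → gcd (value x) v ℕ.% suc v ≡ gcd (value x) v
      small x = m<n⇒m%n≡m (s≤s (ℕ∣.∣⇒≤ (gcd[m,n]∣n (value x) v)))

    v∣ : ∀ {x y z} → Same gcdColouring x y z → h x y ≡ fromℕ⁺ z →
      (v ∣ value x) × (v ∣ value y) × (v ∣ value z)
    v∣ {x} {y} {z} (x∼y , x∼z) eq = v∣x , along (gcd≡ {x} {y} x∼y) , along (gcd≡ {x} {z} x∼z)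
      where
      v∣x : v ∣ value x
      v∣x = cleared⇒∣ {R = R} {S} {x} {y} {z} u⊥v (gcd≡ {x} {y} x∼y) (gcd≡ {x} {z} x∼z)
        (affine⇒cleared {x} {y} {z} eq)
      -- As v ∣ x, the common gcd is v.
      along : ∀ {w} → gcd (value x) v ≡ gcd w v → v ∣ w
      along {w} eq = ℕ∣.∣-trans (ℕ∣.∣-trans (gcd-greatest v∣x ℕ∣.∣-refl) (ℕ∣.∣-reflexive eq)) (gcd[m,n]∣m w v)

    scaledSolutions : Regular h → ∀ κ ws → ∃ λ x → ∃₂ λ y z →
      (∃ λ w → value x ≡ u ℕ.* w) × Solution R S x y z × Same κ x y z × triple x y z ∉ ws
    scaledSolutions reg κ ws =
      let x , y , z , x′ , y′ , z′ , (sx , sy , sz) , eq , same , ∉ws =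
            rescaledSolutions u v {1/ p} inverse {h} gcdColouring (λ {x} {y} {z} → v∣ {x} {y} {z}) reg κ ws
      in x′ , y′ , z′ , (proj₁ sx , proj₂ (proj₂ sx)) ,
         cleared-scaled {u} {v} {R} {S} {x} {y} {z} {x′} {y′} {z′} sx sy sz
           (affine⇒cleared {x} {y} {z} eq) , same , ∉ws

  affine⇒shift : Regular h → Regular (shift (fromℤ R) (fromℤ S))
  affine⇒shift reg κ ws =
    let x , y , z , _ , sol , same , ∉ws = scaledSolutions reg κ ws
    in x , y , z , same , solution⇒shift {R} {S} {x} {y} {z} sol , ∉ws

  -- One rescaled solution suffices: it has x = u w, while the forcing colouring gives u ∣ x + T.
  affine⇒∣ : ∀ {T} → Forcing R S T u → Regular h → + u ℤ∣.∣ T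
  affine⇒∣ {T} force reg =
    let x , y , z , (w , x≡) , sol , same , _ = scaledSolutions reg (colouring force) []
    in ℤ∣.∣m+n∣m⇒∣n {m = + value x} (forced force {x} {y} {z} same sol)
         (ℤ∣.∣ᵤ⇒∣ (subst (u ∣_) (sym x≡) (ℕ∣.m∣m*n w)))

  -- From u ∣ x + T and u ∣ T follows u ∣ x; residues modulo u carry this to y and z, and scaling by
  -- v / u stays within the integers.
  shift⇒affine : ∀ {T} → Forcing R S T u → + u ℤ∣.∣ T →
    Regular (shift (fromℤ R) (fromℤ S)) → Regular h
  shift⇒affine {T} force u∣T reg κ ws =
    let x , y , z , x′ , y′ , z′ , (sx , sy , sz) , eq , same , ∉ws =
          rescaledSolutions v u {p} λv≡u {shift (fromℤ R) (fromℤ S)} (residue value u ⊗ colouring force)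
            (λ {x} {y} {z} → divisible {x} {y} {z}) reg κ ws
    in x′ , y′ , z′ , same ,
       cleared⇒affine {x′} {y′} {z′} (scaled-cleared {u} {v} {R} {S} {x} {y} {z} {x′} {y′} {z′} sx sy sz
         (shift⇒solution {R} {S} {x} {y} {z} eq)) , ∉ws
    where
    divisible : ∀ {x y z} → Same (residue value u ⊗ colouring force) x y z →
      shift (fromℤ R) (fromℤ S) x y ≡ fromℕ⁺ z → (u ∣ value x) × (u ∣ value y) × (u ∣ value z)
    divisible {x} {y} {z} same eq
      with Same-⊗⁻ (residue value u) (colouring force) {x} {y} {z} same
    ... | (x∼y , x∼z) , same′ =
      ℤ∣.∣⇒∣ᵤ u∣x , along (residue⇒∣- value u {x} {y} x∼y) , along (residue⇒∣- value u {x} {z} x∼z)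
      where
      u∣x : + u ℤ∣.∣ + value x
      u∣x = ℤ∣.∣m+n∣n⇒∣m {m = + value x} (forced force {x} {y} {z} same′
        (shift⇒solution {R} {S} {x} {y} {z} eq)) u∣T
      along : ∀ {w} → + u ℤ∣.∣ + value x ℤ.- + w → u ∣ w
      along {w} d = ℤ∣.∣⇒∣ᵤ (subst (+ u ℤ∣.∣_) (i-[i-j]≡j (+ value x) (+ w)) (ℤ∣.∣m∣n⇒∣m-n u∣x d))

  -- Solutions are not rescaled here but built from the exponents given by `Ω`.
  shift⇒affine₀ : R ≡ 0ℤ → S ≡ 0ℤ → Regular (shift (fromℤ R) (fromℤ S)) → Regular h
  shift⇒affine₀ refl refl = multiplicative-transfer u v (λ {x} {y} {z} → cleared⇒affine {x} {y} {z})

squareForcing : ∀ t u .{{_ : NonZero u}} → Forcing ((t ℤ.+ 1ℤ) ℤ.^ 2) (t ℤ.^ 2) (t ℤ.* (t ℤ.+ 1ℤ)) u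
squareForcing t u = record
  { colouring = squareColouring u
  ; forced    = λ {x} {y} {z} → squareColouring⇒∣ u t {x} {y} {z}
  }

productForcing : ∀ {t} → t ≢ 0ℤ → ∀ u .{{_ : NonZero u}} →
  Forcing (t ℤ.* (t ℤ.+ 1ℤ)) (t ℤ.* (t ℤ.- 1ℤ)) (t ℤ.* t) u
productForcing t≢0 u = record
  { colouring = productColouring u t≢0
  ; forced    = λ {x} {y} {z} → productColouring⇒∣ u t≢0 {x} {y} {z}
  }

theoremC : (q : ℚ) .{{_ : Positive q}} (a b : ℕ⁺) (n m t : ℤ) →
    SquareCase q a b n m t ⊎ ProductCase q a b n m t →
    PartitionRegular (affineProduct q a b n m)
    ⇔
    (PartitionRegular (shiftedProduct (q * fromℕ⁺ b * fromℤ n) (q * fromℕ⁺ a * fromℤ m))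
    × ((SquareCase q a b n m t
    × IsInteger ((fromℕ⁺ a * fromℤ m + fromℕ⁺ b * fromℤ n) /2[ a · b ] - 1ℚ /2[ q · a · b ]))
    ⊎
    (ProductCase q a b n m t
    × IsInteger ((fromℕ⁺ a * fromℤ m + fromℕ⁺ b * fromℤ n) /2[ a · b ]))))
theoremC q a b n m t cases =
  reduced (lowestTerms (q * fromℕ⁺ a * fromℕ⁺ b) {{p>0}})
  where
  p>0 : Positive (q * fromℕ⁺ a * fromℕ⁺ b)
  p>0 = ℚ.pos*pos⇒pos (q * fromℕ⁺ a) {{ℚ.pos*pos⇒pos q (fromℕ⁺ a) {{fromℕ⁺-positive a}}}}
          (fromℕ⁺ b) {{fromℕ⁺-positive b}}

  Affine Shifted : Set
  Affine  = PartitionRegular (affineProduct q a b n m)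
  Shifted = PartitionRegular (shiftedProduct (q * fromℕ⁺ b * fromℤ n) (q * fromℕ⁺ a * fromℤ m))

  squareQ productQ : ℚ
  squareQ  = (fromℕ⁺ a * fromℤ m + fromℕ⁺ b * fromℤ n) /2[ a · b ] - 1ℚ /2[ q · a · b ]
  productQ = (fromℕ⁺ a * fromℤ m + fromℕ⁺ b * fromℤ n) /2[ a · b ]

  h : ℕ⁺ → ℕ⁺ → ℚ
  h = affine q a b n m

  reduced : (∃₂ λ u v → NonZero u × NonZero v × Coprime u v ×
                q * fromℕ⁺ a * fromℕ⁺ b * fromℤ (+ v) ≡ fromℤ (+ u)) →
    Affine ⇔ (Shifted × ((SquareCase q a b n m t × IsInteger squareQ) ⊎
                         (ProductCase q a b n m t × IsInteger productQ)))
  reduced (u , v , u≢0 , v≢0 , u⊥v , λv≡u) = mk⇔ (forward cases) backward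
    where
    instance
      _ = u≢0
      _ = v≢0

    module _ {R S : ℤ} (qam≡S : q * fromℕ⁺ a * fromℤ m ≡ fromℤ S)
                       (qbn≡R : q * fromℕ⁺ b * fromℤ n ≡ fromℤ R) where

      toShifted : Affine → Shifted
      toShifted pr = subst₂ (λ r s → PartitionRegular (shiftedProduct r s)) (sym qbn≡R) (sym qam≡S)
        (regular⇒partitionRegular (shift (fromℤ R) (fromℤ S))
          (affine⇒shift q a b n m u⊥v λv≡u qbn≡R qam≡S (partitionRegular⇒regular h pr)))

      shiftedRegular : Shifted → Regular (shift (fromℤ R) (fromℤ S))
      shiftedRegular pr = partitionRegular⇒regular (shift (fromℤ R) (fromℤ S))
        (subst₂ (λ r s → PartitionRegular (shiftedProduct r s)) qbn≡R qam≡S pr)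

      toDivisibility : ∀ {T} → Forcing R S T u → Affine → + u ℤ∣.∣ T
      toDivisibility force pr =
        affine⇒∣ q a b n m u⊥v λv≡u qbn≡R qam≡S force (partitionRegular⇒regular h pr)

      fromShifted : ∀ {T} → Forcing R S T u → + u ℤ∣.∣ T → Shifted → Affine
      fromShifted force u∣T pr = regular⇒partitionRegular h
        (shift⇒affine q a b n m u⊥v λv≡u qbn≡R qam≡S force u∣T (shiftedRegular pr))

      fromShifted₀ : R ≡ 0ℤ → S ≡ 0ℤ → Shifted → Affine
      fromShifted₀ R≡0 S≡0 pr = regular⇒partitionRegular h
        (shift⇒affine₀ q a b n m u⊥v λv≡u qbn≡R qam≡S R≡0 S≡0 (shiftedRegular pr))

    square : SquareCase q a b n m t → squareQ * (q * fromℕ⁺ a * fromℕ⁺ b) ≡ fromℤ (t ℤ.* (t ℤ.+ 1ℤ))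
    square (qam≡ , qbn≡) = squareQuotient q a b n m _ _ (t ℤ.* (t ℤ.+ 1ℤ)) qbn≡ qam≡ (identity t)
      where
      identity : ∀ t → t ℤ.* (t ℤ.* 1ℤ) ℤ.+ (t ℤ.+ 1ℤ) ℤ.* ((t ℤ.+ 1ℤ) ℤ.* 1ℤ) ℤ.- 1ℤ
                       ≡ + 2 ℤ.* (t ℤ.* (t ℤ.+ 1ℤ))
      identity = ℤSolver.solve-∀

    productCase : ProductCase q a b n m t → productQ * (q * fromℕ⁺ a * fromℕ⁺ b) ≡ fromℤ (t ℤ.* t)
    productCase (qam≡ , qbn≡) = productQuotient q a b n m _ _ (t ℤ.* t) qbn≡ qam≡ (identity t)
      where
      identity : ∀ t → t ℤ.* (t ℤ.- 1ℤ) ℤ.+ t ℤ.* (t ℤ.+ 1ℤ) ≡ + 2 ℤ.* (t ℤ.* t)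
      identity = ℤSolver.solve-∀

    forward : SquareCase q a b n m t ⊎ ProductCase q a b n m t → Affine →
      Shifted × ((SquareCase q a b n m t × IsInteger squareQ) ⊎
                 (ProductCase q a b n m t × IsInteger productQ))
    forward (inj₁ sq@(qam≡ , qbn≡)) pr = toShifted qam≡ qbn≡ pr , inj₁ (sq ,
      ∣⇒isInteger {c = squareQ} u⊥v λv≡u (square sq) (toDivisibility qam≡ qbn≡ (squareForcing t u) pr))
    forward (inj₂ pc@(qam≡ , qbn≡)) pr = toShifted qam≡ qbn≡ pr , inj₂ (pc ,
      ∣⇒isInteger {c = productQ} u⊥v λv≡u (productCase pc) (u∣t² (t ℤ.≟ 0ℤ)))
      where
      u∣t² : Dec (t ≡ 0ℤ) → + u ℤ∣.∣ t ℤ.* t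
      -- For t = 0 the number t² is 0, which every u divides, so no forcing colouring is called for.
      u∣t² (yes t≡0) = divides 0ℤ (cong (λ i → i ℤ.* i) t≡0)
      u∣t² (no t≢0)  = toDivisibility qam≡ qbn≡ (productForcing t≢0 u) pr

    backward : Shifted × ((SquareCase q a b n m t × IsInteger squareQ) ⊎
                          (ProductCase q a b n m t × IsInteger productQ)) → Affine
    backward (pr , inj₁ (sq@(qam≡ , qbn≡) , int)) = fromShifted qam≡ qbn≡ (squareForcing t u)
      (isInteger⇒∣ {c = squareQ} u⊥v λv≡u (square sq) int) pr
    backward (pr , inj₂ (pc@(qam≡ , qbn≡) , int)) = split (t ℤ.≟ 0ℤ)
      where
      split : Dec (t ≡ 0ℤ) → Affine
      -- Both shifts t (t + 1) and t (t - 1) vanish, which leaves the multiplicative equation.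
      split (yes t≡0) = fromShifted₀ qam≡ qbn≡
        (cong (λ i → i ℤ.* (i ℤ.+ 1ℤ)) t≡0) (cong (λ i → i ℤ.* (i ℤ.- 1ℤ)) t≡0) pr
      split (no t≢0)  = fromShifted qam≡ qbn≡ (productForcing t≢0 u)
        (isInteger⇒∣ {c = productQ} u⊥v λv≡u (productCase pc) int) pr
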